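{- Let $G=G(n,1/2)$. With probability $1-O(n^{ -1/2})$, for every two distinct vertices $u$ and $v$ of $G$ there is at least one $k\in\{2,3,4\}$ such that $r^k_G(u)\neq r^k_G(v)$.
   Context: $G(n,1/2)$ is the random graph on the vertex set $\{1,\ldots,n\}$ in which each pair of distinct vertices is adjacent with probability $1/2$ independently of the other pairs (i.e. a uniformly random simple graph on $\{1,\ldots,n\}$). For a vertex $v$ of a graph $G$, $r_G^k(v)$ denotes the number of closed walks of length $k$ from $v$, i.e. sequences of vertices $v=v_0,v_1,\ldots,v_k=v$ in which every two successive vertices are adjacent. The $O(\cdot)$ is as $n\to\infty$, with an absolute implied constant. -}

module Defs where

open import Data.Bool.Base using (Bool; true; false; T)
open import Data.Bool.Properties using (T?)
open import Data.Fin.Base using (Fin; zero; suc)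
open import Data.Fin.Properties using (all?) renaming (_≟_ to _≟ᶠ_)
open import Data.Integer.Base using (+_)
open import Data.List.Base as List
  using (List; length; filter; allFin; cartesianProductWith)
open import Data.List.Membership.Propositional using (_∈_; find; lose)
open import Data.List.Membership.Propositional.Properties
  using (∈-cartesianProductWith⁺; ∈-length)
open import Data.List.Relation.Unary.All as All using ()
open import Data.List.Relation.Unary.AllPairs as AllPairs using ()
open import Data.List.Relation.Unary.Any using (here; there; any?)
open import Data.List.Relation.Unary.Unique.Propositional using (Unique)
open import Data.List.Relation.Unary.Unique.Propositional.Properties
  using (cartesianProductWith⁺)
open import Data.Nat.Base as ℕ using (ℕ; zero; suc; NonZero; >-nonZero)
import Data.Nat.Properties as ℕ
open import Data.Product.Base using (∃-syntax; _×_; _,_)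
open import Data.Rational.Unnormalised.Base using (ℚᵘ; _/_; _*_; _≤_)
open import Data.Vec.Base as Vec using (Vec; []; _∷_; lookup; tabulate; head; last)
open import Data.Vec.Properties using (∷-injective; lookup∘tabulate)
open import Data.Vec.Relation.Binary.Pointwise.Extensional using (ext; Pointwise-≡⇒≡)
open import Data.Vec.Relation.Unary.Linked using (Linked; linked?)
open import Level using (Level)
open import Relation.Binary.PropositionalEquality
  using (_≡_; _≢_; refl; sym; trans; cong₂)
open import Relation.Nullary.Decidable using (map′; _×-dec_; _→-dec_; ¬?)
open import Relation.Unary using (Pred; Decidable)

private
  variable
    a p : Level
    n : ℕ

-- A simple graph on n labelled vertices, one bit per unordered pair of distinct
-- vertices: in `row ∷ G` the bits of `row` join the new vertex `zero` to the
-- vertices of `G`, which are renumbered by `suc`.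

infixr 5 _∷_

data Graph : ℕ → Set where
  []  : Graph 0
  _∷_ : Vec Bool n → Graph n → Graph (suc n)

adj : Graph n → Fin n → Fin n → Bool
adj (row ∷ G) zero    zero    = false
adj (row ∷ G) zero    (suc v) = lookup row v
adj (row ∷ G) (suc u) zero    = lookup row u
adj (row ∷ G) (suc u) (suc v) = adj G u v

Adj : Graph n → Fin n → Fin n → Set
Adj G u v = T (adj G u v)

-- `adj` is a bijection onto the symmetric irreflexive relations.

adj-irrefl : (G : Graph n) → ∀ u → adj G u u ≡ false
adj-irrefl (row ∷ G) zero    = refl
adj-irrefl (row ∷ G) (suc u) = adj-irrefl G u

adj-sym : (G : Graph n) → ∀ u v → adj G u v ≡ adj G v u
adj-sym (row ∷ G) zero    zero    = refl
adj-sym (row ∷ G) zero    (suc v) = refl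
adj-sym (row ∷ G) (suc u) zero    = refl
adj-sym (row ∷ G) (suc u) (suc v) = adj-sym G u v

adj-injective : (G H : Graph n) → (∀ u v → adj G u v ≡ adj H u v) → G ≡ H
adj-injective []        []        eq = refl
adj-injective (row ∷ G) (col ∷ H) eq = cong₂ _∷_
  (Pointwise-≡⇒≡ (ext (λ v → eq zero (suc v))))
  (adj-injective G H (λ u v → eq (suc u) (suc v)))

adj-surjective : (f : Fin n → Fin n → Bool) →
                 (∀ u → f u u ≡ false) → (∀ u v → f u v ≡ f v u) →
                 ∃[ G ] (∀ u v → adj {n} G u v ≡ f u v)
adj-surjective {zero}  f irr symm = [] , λ ()
adj-surjective {suc n} f irr symm
  with G , G≗f ← adj-surjective (λ u v → f (suc u) (suc v))
                   (λ u → irr (suc u)) (λ u v → symm (suc u) (suc v))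
  = tabulate row ∷ G , λ where
      zero    zero    → sym (irr zero)
      zero    (suc v) → lookup∘tabulate row v
      (suc u) zero    → trans (lookup∘tabulate row u) (symm zero (suc u))
      (suc u) (suc v) → G≗f u v
  where
  row : Fin n → Bool
  row v = f zero (suc v)

vectors : {A : Set a} → List A → ∀ k → List (Vec A k)
vectors xs zero    = List.[ [] ]
vectors xs (suc k) = cartesianProductWith _∷_ xs (vectors xs k)

∈-vectors : {A : Set a} {xs : List A} → (∀ x → x ∈ xs) →
            ∀ {k} (w : Vec A k) → w ∈ vectors xs k
∈-vectors ∈xs []      = here refl
∈-vectors ∈xs (x ∷ w) = ∈-cartesianProductWith⁺ _∷_ (∈xs x) (∈-vectors ∈xs w)

vectors-unique : {A : Set a} {xs : List A} → Unique xs → ∀ k → Unique (vectors xs k)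
vectors-unique xs! zero    = All.[] AllPairs.∷ AllPairs.[]
vectors-unique xs! (suc k) =
  cartesianProductWith⁺ _∷_ ∷-injective xs! (vectors-unique xs! k)

bools : List Bool
bools = false List.∷ true List.∷ List.[]

∈-bools : ∀ b → b ∈ bools
∈-bools false = here refl
∈-bools true  = there (here refl)

bools-unique : Unique bools
bools-unique = ((λ ()) All.∷ All.[]) AllPairs.∷ All.[] AllPairs.∷ AllPairs.[]

graphs : ∀ n → List (Graph n)
graphs zero    = List.[ [] ]
graphs (suc n) = cartesianProductWith _∷_ (vectors bools n) (graphs n)

∈-graphs : (G : Graph n) → G ∈ graphs n
∈-graphs []        = here refl
∈-graphs (row ∷ G) =
  ∈-cartesianProductWith⁺ _∷_ (∈-vectors ∈-bools row) (∈-graphs G)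

graphs-unique : ∀ n → Unique (graphs n)
graphs-unique zero    = All.[] AllPairs.∷ AllPairs.[]
graphs-unique (suc n) = cartesianProductWith⁺ _∷_ (λ { refl → refl , refl })
  (vectors-unique bools-unique n) (graphs-unique n)

emptyGraph : ∀ n → Graph n
emptyGraph zero    = []
emptyGraph (suc n) = Vec.replicate n false ∷ emptyGraph n

graphs-nonZero : ∀ n → NonZero (length (graphs n))
graphs-nonZero n = >-nonZero (∈-length (∈-graphs (emptyGraph n)))

-- The probability that G(n,1/2) satisfies a decidable property.

Pr : {P : Pred (Graph n) p} → Decidable P → ℚᵘ
Pr {n = n} P? = + length (filter P? (graphs n)) / length (graphs n)
  where instance _ = graphs-nonZero n

-- The vector lists the k + 1 vertices v₀, v₁, …, vₖ.

IsClosedWalk : Graph n → (k : ℕ) → Fin n → Vec (Fin n) (suc k) → Set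
IsClosedWalk G k v w = head w ≡ v × last w ≡ v × Linked (Adj G) w

isClosedWalk? : (G : Graph n) (k : ℕ) (v : Fin n) → Decidable (IsClosedWalk G k v)
isClosedWalk? G k v w =
  (head w ≟ᶠ v) ×-dec (last w ≟ᶠ v) ×-dec linked? (λ x y → T? (adj G x y)) w

r : Graph n → ℕ → Fin n → ℕ
r {n} G k v = length (filter (isClosedWalk? G k v) (vectors (allFin n) (suc k)))

Distinguished : Graph n → Set
Distinguished {n} G = (u v : Fin n) → u ≢ v →
  ∃[ k ] (k ∈ 2 List.∷ 3 List.∷ 4 List.∷ List.[] × r G k u ≢ r G k v)

distinguished? : Decidable (Distinguished {n})
distinguished? G = all? λ u → all? λ v → ¬? (u ≟ᶠ v) →-dec
  map′ find (λ (_ , k∈ , ≢) → lose k∈ ≢)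
    (any? (λ k → ¬? (r G k u ℕ.≟ r G k v)) (2 List.∷ 3 List.∷ 4 List.∷ List.[]))

-- f(n) = O(n^{-1/2}) as n → ∞.  The bound |f(n)| ≤ C n^{-1/2} is squared, since
-- √n need not be rational.

infix 4 _∈O[n^-½]

_∈O[n^-½] : (ℕ → ℚᵘ) → Set
f ∈O[n^-½] = ∃[ C ] ∃[ N ] ∀ n → N ℕ.≤ n → f n * f n * (+ n / 1) ≤ C * C

{-# OPTIONS --safe #-}
module Submission where

-- Move a given pair of vertices to 0 and 1, let p and q be their rows, and let A be the
-- set of neighbours of 0 only and D the set of common non-neighbours.  Equal degrees have
-- probability O(n^{-1/2}).  Given p and q, the number of closed 3-walks from 0 strictly
-- increases with every edge inside A, whereas that from 1 ignores these edges; by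
-- Sperner's theorem the two agree with probability O(1/|A|).  The number of closed
-- 4-walks from 0 strictly increases with every edge between A and D, whereas that from 1
-- and both numbers of closed 3-walks ignore these edges, so Sperner's theorem gives a
-- further independent factor O((|A||D|)^{-1/2}).  As |A|, |D| ≥ s ≈ n/32 up to an
-- exponentially small probability, a given pair fails with probability O(n^{-5/2}), and a
-- union bound over the pairs finishes the proof.

open import Defs
open import Data.Bool.Base using (Bool; true; false; _∧_; _∨_; not; if_then_else_)
open import Data.Bool.Properties using (T?; ∧-comm; ∨-comm; ∧-zeroʳ)
open import Data.Fin.Base using (Fin; zero; suc; punchOut)
open import Data.Fin.Permutation as Perm using (Permutation′; _⟨$⟩ʳ_; _⟨$⟩ˡ_)
open import Data.Fin.Properties using (all?; punchIn-punchOut; ¬∀⟶∃¬) renaming (_≟_ to _≟ᶠ_)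
open import Data.Integer.Base as ℤ using (+≤+)
import Data.Integer.Properties as ℤ
open import Data.Integer.Tactic.RingSolver using () renaming (solve-∀ to solveℤ-∀)
open import Data.List.Base as List using (List; []; _∷_; allFin; cartesianProductWith; filter; length)
open import Data.List.Membership.Propositional using (_∈_)
open import Data.List.Membership.Propositional.Properties using (∈-map⁺)
open import Data.List.Membership.Propositional.Properties.WithK using (unique∧set⇒bag)
open import Data.List.Properties using (map-cong; map-++; map-∘; map-tabulate; length-map)
open import Data.List.Relation.Binary.BagAndSetEquality using (∼bag⇒↭)
open import Data.List.Relation.Binary.Permutation.Propositional using (_↭_)
import Data.List.Relation.Binary.Permutation.Propositional.Properties as ↭
open import Data.List.Relation.Unary.All as All using (All; []; _∷_)
import Data.List.Relation.Unary.All.Properties as All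
open import Data.List.Relation.Unary.Any using (here; there)
open import Data.List.Relation.Unary.Linked as Linked using (Linked; []; [-]; _∷_)
import Data.List.Relation.Unary.Linked.Properties as Linked
import Data.List.Relation.Unary.Unique.Propositional.Properties as Unique
open import Data.Nat.Base
open import Data.Nat.Combinatorics using (_C_; nCk≡nC[n∸k]; nCk+nC[k+1]≡[n+1]C[k+1]; nC1≡n)
open import Data.Nat.DivMod using (_/_; _%_; m≡m%n+[m/n]*n; m%n<n; m/n*n≤m; m≥n⇒m/n>0)
open import Data.Nat.ListAction using () renaming (sum to sumˡ)
open import Data.Nat.ListAction.Properties using (sum-++; sum-↭)
open import Data.Nat.Properties
open import Data.Nat.Tactic.RingSolver using (solve-∀)
open import Data.Product.Base using (∃-syntax; ∃₂; _×_; _,_; proj₁; proj₂; map)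
open import Data.Rational.Unnormalised.Base as ℚᵘ using (1ℚᵘ; _-_; _≃_; *≤*; *≡*)
import Data.Rational.Unnormalised.Properties as ℚᵘ
open import Data.Sum.Base using (_⊎_; inj₁; inj₂)
open import Data.Unit.Base using (tt)
open import Data.Vec.Base as Vec using (Vec; []; _∷_; _++_; drop; head; last; lookup; replicate; take)
open import Data.Vec.Relation.Unary.Linked as Linkedᵛ using (linked?; []; [-]; _∷_)
open import Function.Base using (_∘_)
open import Function.Bundles using (mk⇔)
open import Relation.Binary.PropositionalEquality hiding ([_])
open import Relation.Nullary
open import Relation.Nullary.Decidable using (_×-dec_; _→-dec_; ¬?; map′; decidable-stable)
open import Relation.Unary using (Decidable)
open import Algebra.Properties.Semiring.Sum +-*-semiring
  using (sum; sum-cong-≗; sum-replicate-zero; sum-permute; ∑-distrib-+; ∑-comm; *-distribˡ-sum; *-distribʳ-sum)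

-- The exponent is 1/2 + 1 + 1. Each stage gains the square root of the number of bits still free,
-- and these are of order `n` for a row and `n²` for either set of edges. The walk counts are not
-- sums of independent bits. The square of a path count is not even linear, so no local limit
-- theorem applies directly. Strict monotonicity is available, and it makes the solutions of an
-- equation an antichain in the free bits. The factors multiply because Sperner's theorem is proved
-- for weighted counts: the weight is the event already secured, and it only has to ignore the bits
-- in use. This determines the set D. Its vertices miss 1, so that edges from A to D change nothing
-- seen from 1. They also miss 0, so that these edges close no triangle at 0, while a 4-walk from 0
-- can still go along such an edge and back. Probabilities appear as counts cleared of denominators,
-- and bounds containing a root appear squared.

private variable
  n : ℕ

-- Middle binomial coefficients

-- L n k is the sum of the k largest binomial coefficients n C i.

L : ℕ → ℕ → ℕ
L zero    zero    = 0
L zero    (suc k) = 1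
L (suc n) zero    = 0
L (suc n) (suc k) = L n (2 + k) + L n k

middle-symmetric : ∀ n → n C ⌈ n /2⌉ ≡ n C ⌊ n /2⌋
middle-symmetric n = trans (nCk≡nC[n∸k] (⌈n/2⌉≤n n)) (cong (n C_) eq)
  where
  eq : n ∸ ⌈ n /2⌉ ≡ ⌊ n /2⌋
  eq = trans (cong (_∸ ⌈ n /2⌉) (sym (⌊n/2⌋+⌈n/2⌉≡n n))) (m+n∸n≡m ⌊ n /2⌋ ⌈ n /2⌉)

L-zero : ∀ n → L n 0 ≡ 0
L-zero zero    = refl
L-zero (suc n) = refl

-- The coefficients of row `n`, listed outwards from the middle, come in equal pairs. Hence
-- `⌈ n + k /2⌉` can always name the one in the upper half, and past the end of the row it gives 0.
-- With this ordering the recursion of `L`, which is shaped by the splitting of chains, becomes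
-- Pascal's rule.
L-suc : ∀ n k → L n (suc k) ≡ L n k + n C ⌈ n + k /2⌉
L-suc zero    zero    = refl
L-suc zero    (suc k) = refl
L-suc (suc n) zero    = begin
  L n 2 + L n 0                               ≡⟨ cong (L n 2 +_) (L-zero n) ⟩
  L n 2 + 0                                   ≡⟨ +-identityʳ _ ⟩
  L n 2                                       ≡⟨ L-suc n 1 ⟩
  L n 1 + n C ⌈ n + 1 /2⌉
    ≡⟨ cong₂ _+_ (trans (L-suc n 0) (cong₂ _+_ (L-zero n) (cong (λ m → n C ⌈ m /2⌉) (+-identityʳ n))))
         (cong (λ m → n C ⌈ m /2⌉) (+-comm n 1)) ⟩
  n C ⌈ n /2⌉ + n C suc ⌊ n /2⌋               ≡⟨ cong (_+ n C suc ⌊ n /2⌋) (middle-symmetric n) ⟩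
  n C ⌊ n /2⌋ + n C suc ⌊ n /2⌋               ≡⟨ nCk+nC[k+1]≡[n+1]C[k+1] n ⌊ n /2⌋ ⟩
  suc n C suc ⌊ n /2⌋                         ≡⟨ cong (λ m → suc n C ⌈ suc m /2⌉) (+-identityʳ n) ⟨
  suc n C ⌈ suc n + 0 /2⌉                     ∎
  where open ≡-Reasoning
L-suc (suc n) (suc k) = begin
  L n (3 + k) + L n (suc k)
    ≡⟨ cong₂ _+_ (L-suc n (2 + k)) (L-suc n k) ⟩
  (L n (2 + k) + n C ⌈ n + (2 + k) /2⌉) + (L n k + n C ⌈ n + k /2⌉)
    ≡⟨ rearrange (L n (2 + k)) _ (L n k) _ ⟩
  (L n (2 + k) + L n k) + (n C ⌈ n + k /2⌉ + n C ⌈ n + (2 + k) /2⌉)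
    ≡⟨ cong (λ m → L (suc n) (suc k) + (n C ⌈ n + k /2⌉ + n C ⌈ m /2⌉))
         (trans (+-suc n (suc k)) (cong suc (+-suc n k))) ⟩
  L (suc n) (suc k) + (n C ⌈ n + k /2⌉ + n C suc ⌈ n + k /2⌉)
    ≡⟨ cong (L (suc n) (suc k) +_) (nCk+nC[k+1]≡[n+1]C[k+1] n ⌈ n + k /2⌉) ⟩
  L (suc n) (suc k) + suc n C suc ⌈ n + k /2⌉
    ≡⟨ cong (λ m → L (suc n) (suc k) + suc n C ⌈ suc m /2⌉) (+-suc n k) ⟨
  L (suc n) (suc k) + suc n C ⌈ suc n + suc k /2⌉                 ∎
  where
  open ≡-Reasoning
  rearrange : ∀ a b c d → (a + b) + (c + d) ≡ (a + c) + (d + b)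
  rearrange = solve-∀

L-one : ∀ n → L n 1 ≡ n C ⌈ n /2⌉
L-one n = trans (L-suc n 0) (cong₂ _+_ (L-zero n) (cong (λ m → n C ⌈ m /2⌉) (+-identityʳ n)))

absorption : ∀ n k → suc k * (suc n C suc k) ≡ suc n * (n C k)
absorption zero    zero    = refl
absorption zero    (suc k) = trans (*-zeroʳ k) (sym (+-identityʳ _))
absorption (suc n) zero    = trans (+-identityʳ _) (trans (nC1≡n (2 + n)) (sym (*-identityʳ (2 + n))))
absorption (suc n) (suc k) = begin
  (2 + k) * ((2 + n) C (2 + k))
    ≡⟨ cong ((2 + k) *_) (nCk+nC[k+1]≡[n+1]C[k+1] (suc n) (suc k)) ⟨
  (2 + k) * (c + suc n C (2 + k))                       ≡⟨ split k c (suc n C (2 + k)) ⟩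
  c + suc k * c + (2 + k) * (suc n C (2 + k))
    ≡⟨ cong₂ (λ a b → c + a + b) (absorption n k) (absorption n (suc k)) ⟩
  c + suc n * (n C k) + suc n * (n C suc k)             ≡⟨ merge n c (n C k) (n C suc k) ⟩
  c + suc n * (n C k + n C suc k)
    ≡⟨ cong (λ a → c + suc n * a) (nCk+nC[k+1]≡[n+1]C[k+1] n k) ⟩
  (2 + n) * c                                           ∎
  where
  open ≡-Reasoning
  c = suc n C suc k
  split : ∀ k c d → (2 + k) * (c + d) ≡ c + suc k * c + (2 + k) * d
  split = solve-∀
  merge : ∀ n c d e → c + suc n * d + suc n * e ≡ c + suc n * (d + e)
  merge = solve-∀

module _ where
  open ≤-Reasoning

  centralEven : ℕ → ℕ
  centralEven j = (j + j) C j

  centralOdd : ℕ → ℕ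
  centralOdd j = suc (j + j) C suc j

  centralEven-suc : ∀ j → centralEven (suc j) ≡ 2 * centralOdd j
  centralEven-suc j = begin-equality
    suc (j + suc j) C suc j                         ≡⟨ cong (λ m → suc m C suc j) (+-suc j j) ⟩
    (2 + (j + j)) C suc j                           ≡⟨ nCk+nC[k+1]≡[n+1]C[k+1] (suc (j + j)) j ⟨
    suc (j + j) C j + centralOdd j
      ≡⟨ cong (_+ centralOdd j) (nCk≡nC[n∸k] (m≤n⇒m≤1+n (m≤m+n j j))) ⟩
    suc (j + j) C (suc (j + j) ∸ j) + centralOdd j
      ≡⟨ cong (λ m → suc (j + j) C m + centralOdd j) (m+n∸n≡m (suc j) j) ⟩
    centralOdd j + centralOdd j                     ≡⟨ cong (centralOdd j +_) (+-identityʳ _) ⟨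
    2 * centralOdd j                                ∎

  -- Induction alternating between even and odd rows. From odd to even nothing is lost, since the
  -- coefficient exactly doubles. From even to odd, absorption leaves `(2j+1)(2j+3) ≤ 4(j+1)²`. The
  -- odd bound carries `3 + (j + j)`, one more than `L-one-bound` asks for, because the next even
  -- row needs it.
  centralEven-bound : ∀ j → centralEven j * centralEven j * suc (j + j) ≤ 4 ^ (j + j)
  centralOdd-bound : ∀ j → centralOdd j * centralOdd j * (3 + (j + j)) ≤ 4 ^ suc (j + j)

  centralEven-bound zero    = ≤-refl
  centralEven-bound (suc j) = begin
    centralEven (suc j) * centralEven (suc j) * suc (suc j + suc j)
      ≡⟨ cong₂ (λ b m → b * b * (2 + m)) (centralEven-suc j) (+-suc j j) ⟩
    2 * c * (2 * c) * (3 + (j + j))                                 ≡⟨ regroup c (3 + (j + j)) ⟩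
    4 * (c * c * (3 + (j + j)))                                     ≤⟨ *-monoʳ-≤ 4 (centralOdd-bound j) ⟩
    4 ^ (2 + (j + j))                                               ≡⟨ cong (λ m → 4 ^ suc m) (+-suc j j) ⟨
    4 ^ (suc j + suc j)                                             ∎
    where
    c = centralOdd j
    regroup : ∀ c d → 2 * c * (2 * c) * d ≡ 4 * (c * c * d)
    regroup = solve-∀

  centralOdd-bound j = *-cancelˡ-≤ (suc j * suc j) (begin
    suc j * suc j * (c * c * (3 + (j + j)))
      ≡⟨ regroup₁ (suc j) c (3 + (j + j)) ⟩
    suc j * c * (suc j * c) * (3 + (j + j))
      ≡⟨ cong (λ x → x * x * (3 + (j + j))) (absorption (j + j) j) ⟩
    suc (j + j) * b * (suc (j + j) * b) * (3 + (j + j))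
      ≡⟨ regroup₂ (suc (j + j)) b (3 + (j + j)) ⟩
    b * b * suc (j + j) * (suc (j + j) * (3 + (j + j)))
      ≤⟨ *-monoˡ-≤ _ (centralEven-bound j) ⟩
    4 ^ (j + j) * (suc (j + j) * (3 + (j + j)))
      ≤⟨ *-monoʳ-≤ (4 ^ (j + j)) (≤-trans (n≤1+n _) (≤-reflexive (square j))) ⟩
    4 ^ (j + j) * (4 * (suc j * suc j))
      ≡⟨ regroup₃ (4 ^ (j + j)) (suc j * suc j) ⟩
    suc j * suc j * 4 ^ suc (j + j)                                         ∎)
    where
    b = centralEven j
    c = centralOdd j
    regroup₁ : ∀ a c d → a * a * (c * c * d) ≡ a * c * (a * c) * d
    regroup₁ = solve-∀
    regroup₂ : ∀ a b d → a * b * (a * b) * d ≡ b * b * a * (a * d)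
    regroup₂ = solve-∀
    regroup₃ : ∀ a b → a * (4 * b) ≡ b * (4 * a)
    regroup₃ = solve-∀
    square : ∀ j → suc (suc (j + j) * (3 + (j + j))) ≡ 4 * (suc j * suc j)
    square = solve-∀

  even-or-odd : ∀ n → (∃[ j ] n ≡ j + j) ⊎ (∃[ j ] n ≡ suc (j + j))
  even-or-odd zero    = inj₁ (0 , refl)
  even-or-odd (suc n) with even-or-odd n
  ... | inj₁ (j , refl) = inj₂ (j , refl)
  ... | inj₂ (j , refl) = inj₁ (suc j , cong suc (sym (+-suc j j)))

  L-one-bound : ∀ n → L n 1 * L n 1 * suc n ≤ 4 ^ n
  L-one-bound n rewrite L-one n with even-or-odd n
  ... | inj₁ (j , refl) rewrite sym (n≡⌈n+n/2⌉ j) = centralEven-bound j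
  ... | inj₂ (j , refl) rewrite sym (n≡⌊n+n/2⌋ j) =
    ≤-trans (*-monoʳ-≤ (centralOdd j * centralOdd j) (n≤1+n _)) (centralOdd-bound j)

^-distribʳ-* : ∀ m n k → (m * n) ^ k ≡ m ^ k * n ^ k
^-distribʳ-* m n zero    = refl
^-distribʳ-* m n (suc k) = trans (cong (m * n *_) (^-distribʳ-* m n k)) (interchange m n (m ^ k) (n ^ k))
  where
  interchange : ∀ a b c d → a * b * (c * d) ≡ a * c * (b * d)
  interchange = solve-∀

-- Square roots are avoided by comparing with an integer s ≤ 2 √(n + 1).
L-one-scaled : ∀ n s → s * s ≤ 4 * suc n → L n 1 * s ≤ 2 * 2 ^ n
L-one-scaled n s s²≤ = square-cancel-≤ (begin
  L n 1 * s * (L n 1 * s)      ≡⟨ regroup₁ (L n 1) s ⟩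
  L n 1 * L n 1 * (s * s)      ≤⟨ *-monoʳ-≤ (L n 1 * L n 1) s²≤ ⟩
  L n 1 * L n 1 * (4 * suc n)  ≡⟨ regroup₂ (L n 1) (suc n) ⟩
  4 * (L n 1 * L n 1 * suc n)  ≤⟨ *-monoʳ-≤ 4 (L-one-bound n) ⟩
  4 * 4 ^ n                    ≡⟨ cong (4 *_) (^-distribʳ-* 2 2 n) ⟩
  4 * (2 ^ n * 2 ^ n)          ≡⟨ regroup₃ (2 ^ n) ⟩
  2 * 2 ^ n * (2 * 2 ^ n)      ∎)
  where
  open ≤-Reasoning
  regroup₁ : ∀ a s → a * s * (a * s) ≡ a * a * (s * s)
  regroup₁ = solve-∀
  regroup₂ : ∀ a s → a * a * (4 * s) ≡ 4 * (a * a * s)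
  regroup₂ = solve-∀
  regroup₃ : ∀ a → 4 * (a * a) ≡ 2 * a * (2 * a)
  regroup₃ = solve-∀
  square-cancel-≤ : ∀ {a b} → a * a ≤ b * b → a ≤ b
  square-cancel-≤ {a} {b} a²≤b² with a ≤? b
  ... | yes a≤b = a≤b
  ... | no  a≰b = contradiction a²≤b² (<⇒≱ (*-mono-< (≰⇒> a≰b) (≰⇒> a≰b)))

-- Sperner’s theorem

⟦_⟧ : Bool → ℕ
⟦ false ⟧ = 0
⟦ true  ⟧ = 1

[_] : ∀ {p} {P : Set p} → Dec P → ℕ
[ P? ] = ⟦ does P? ⟧

[]-yes : ∀ {p} {P : Set p} (P? : Dec P) → P → [ P? ] ≡ 1
[]-yes (yes _) _ = refl
[]-yes (no ¬p) p = contradiction p ¬p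

[]-no : ∀ {p} {P : Set p} (P? : Dec P) → ¬ P → [ P? ] ≡ 0
[]-no (yes p) ¬p = contradiction p ¬p
[]-no (no _)  _  = refl

[]-cong : ∀ {p q} {P : Set p} {Q : Set q} (P? : Dec P) (Q? : Dec Q) → (P → Q) → (Q → P) → [ P? ] ≡ [ Q? ]
[]-cong (yes p) Q? f g = sym ([]-yes Q? (f p))
[]-cong (no ¬p) Q? f g = sym ([]-no Q? (¬p ∘ g))

[]-mono : ∀ {p q} {P : Set p} {Q : Set q} (P? : Dec P) (Q? : Dec Q) → (P → Q) → [ P? ] ≤ [ Q? ]
[]-mono (yes p) Q? f = ≤-reflexive (sym ([]-yes Q? (f p)))
[]-mono (no ¬p) Q? f = z≤n

⟦⟧≤1 : ∀ b → ⟦ b ⟧ ≤ 1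
⟦⟧≤1 false = z≤n
⟦⟧≤1 true  = ≤-refl

∑ᵛ : ∀ n → (Vec Bool n → ℕ) → ℕ
∑ᵛ zero    f = f []
∑ᵛ (suc n) f = ∑ᵛ n (f ∘ (false ∷_)) + ∑ᵛ n (f ∘ (true ∷_))

∑ᵛ-cong : ∀ n {f g : Vec Bool n → ℕ} → f ≗ g → ∑ᵛ n f ≡ ∑ᵛ n g
∑ᵛ-cong zero    f≗g = f≗g []
∑ᵛ-cong (suc n) f≗g = cong₂ _+_ (∑ᵛ-cong n (f≗g ∘ (false ∷_))) (∑ᵛ-cong n (f≗g ∘ (true ∷_)))

∑ᵛ-mono : ∀ n {f g : Vec Bool n → ℕ} → (∀ p → f p ≤ g p) → ∑ᵛ n f ≤ ∑ᵛ n g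
∑ᵛ-mono zero    f≤g = f≤g []
∑ᵛ-mono (suc n) f≤g = +-mono-≤ (∑ᵛ-mono n (f≤g ∘ (false ∷_))) (∑ᵛ-mono n (f≤g ∘ (true ∷_)))

∑ᵛ-+ : ∀ n (f g : Vec Bool n → ℕ) → ∑ᵛ n (λ p → f p + g p) ≡ ∑ᵛ n f + ∑ᵛ n g
∑ᵛ-+ zero    f g = refl
∑ᵛ-+ (suc n) f g = trans
  (cong₂ _+_ (∑ᵛ-+ n (f ∘ (false ∷_)) (g ∘ (false ∷_))) (∑ᵛ-+ n (f ∘ (true ∷_)) (g ∘ (true ∷_))))
  (interchange (∑ᵛ n (f ∘ (false ∷_))) (∑ᵛ n (g ∘ (false ∷_))) (∑ᵛ n (f ∘ (true ∷_)))
      (∑ᵛ n (g ∘ (true ∷_))))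
  where
  interchange : ∀ a b c d → a + b + (c + d) ≡ a + c + (b + d)
  interchange = solve-∀

∑ᵛ-*ˡ : ∀ n c (f : Vec Bool n → ℕ) → ∑ᵛ n (λ p → c * f p) ≡ c * ∑ᵛ n f
∑ᵛ-*ˡ zero    c f = refl
∑ᵛ-*ˡ (suc n) c f = trans (cong₂ _+_ (∑ᵛ-*ˡ n c (f ∘ (false ∷_))) (∑ᵛ-*ˡ n c (f ∘ (true ∷_))))
      (sym (*-distribˡ-+ c _ _))

∑ᵛ-const : ∀ n c → ∑ᵛ n (λ _ → c) ≡ 2 ^ n * c
∑ᵛ-const zero    c = sym (+-identityʳ c)
∑ᵛ-const (suc n) c rewrite ∑ᵛ-const n c = double (2 ^ n) c
  where
  double : ∀ a c → a * c + a * c ≡ 2 * a * c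
  double = solve-∀

∑ᵛ-++ : ∀ m n (f : Vec Bool (m + n) → ℕ) → ∑ᵛ (m + n) f ≡ ∑ᵛ m λ p → ∑ᵛ n λ q → f (p ++ q)
∑ᵛ-++ zero    n f = refl
∑ᵛ-++ (suc m) n f = cong₂ _+_ (∑ᵛ-++ m n _) (∑ᵛ-++ m n _)

-- The covering relation of the cube in the coordinates marked by `M`. Single covers are all that
-- the chain argument compares, so no order on vectors is introduced.
data Raise : Vec Bool n → Vec Bool n → Vec Bool n → Set where
  here  : ∀ {M p : Vec Bool n} → Raise (true ∷ M) (false ∷ p) (true ∷ p)
  there : ∀ {M p p′ : Vec Bool n} {m b} → Raise M p p′ → Raise (m ∷ M) (b ∷ p) (b ∷ p′)

ones : Vec Bool n → ℕ
ones []      = 0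
ones (b ∷ p) = ⟦ b ⟧ + ones p

Invariant Increasing : Vec Bool n → (Vec Bool n → ℕ) → Set
Invariant  M f = ∀ p p′ → Raise M p p′ → f p ≡ f p′
Increasing M f = ∀ p p′ → Raise M p p′ → f p < f p′

_≻_ : (f g : Vec Bool n → ℕ) → Set
f ≻ g = ∀ p → g p < f p

-- The weight `h` plays the role of an event conditioned on, and `t` is a target that may vary with
-- the bits held fixed. One sum thus treats all settings of the unmasked bits together.
hits : (h t f : Vec Bool n → ℕ) → ℕ
hits {n} h t f = ∑ᵛ n λ p → h p * [ f p ≟ t p ]

private
  restrict : Bool → (Vec Bool (suc n) → ℕ) → (Vec Bool n → ℕ)
  restrict b f = f ∘ (b ∷_)

  ∑hits : (h t : Vec Bool n → ℕ) → List (Vec Bool n → ℕ) → ℕ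
  ∑hits h t fs = sumˡ (List.map (hits h t) fs)

  restricts-increasing : ∀ {m} b {M : Vec Bool n} {fs} → All (Increasing (m ∷ M)) fs → All
      (Increasing M) (List.map (restrict b) fs)
  restricts-increasing b fs↑ = All.map⁺ (All.map (λ f↑ p p′ → f↑ _ _ ∘ there) fs↑)

  restricts-≻ : ∀ b {fs : List (Vec Bool (suc n) → ℕ)} → Linked _≻_ fs → Linked _≻_
      (List.map (restrict b) fs)
  restricts-≻ b fs≻ = Linked.map⁺ (Linked.map (λ f≻g → f≻g ∘ (b ∷_)) fs≻)

  ∑hits-cong : ∀ {h h′ t t′ : Vec Bool n → ℕ} → h ≗ h′ → t ≗ t′ → ∀ fs → ∑hits h t fs ≡ ∑hits h′ t′ fs
  ∑hits-cong {n} h≗ t≗ fs = cong sumˡ (map-cong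
    (λ f → ∑ᵛ-cong n λ p → cong₂ (λ x y → x * [ f p ≟ y ]) (h≗ p) (t≗ p)) fs)

  ∑hits-restrict : ∀ (h t : Vec Bool (suc n) → ℕ) fs → ∑hits h t fs ≡
    ∑hits (restrict false h) (restrict false t) (List.map (restrict false) fs) +
    ∑hits (restrict true h) (restrict true t) (List.map (restrict true) fs)
  ∑hits-restrict h t []       = refl
  ∑hits-restrict h t (f ∷ fs) = trans (cong (hits h t f +_) (∑hits-restrict h t fs))
    (interchange (part false) (part true) (parts false) (parts true))
    where
    part parts : Bool → ℕ
    part  b = hits (restrict b h) (restrict b t) (restrict b f)
    parts b = ∑hits (restrict b h) (restrict b t) (List.map (restrict b) fs)
    interchange : ∀ a b c d → a + b + (c + d) ≡ a + c + (b + d)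
    interchange = solve-∀

  hit-≡ : ∀ (h t f : Vec Bool 0 → ℕ) → f [] ≡ t [] → hits h t f ≡ h []
  hit-≡ h t f eq = trans (cong (h [] *_) ([]-yes (f [] ≟ t []) eq)) (*-identityʳ (h []))

  hit-≢ : ∀ (h t f : Vec Bool 0 → ℕ) → f [] ≢ t [] → hits h t f ≡ 0
  hit-≢ h t f neq = trans (cong (h [] *_) ([]-no (f [] ≟ t []) neq)) (*-zeroʳ (h []))

  no-hit : ∀ h t (f : Vec Bool 0 → ℕ) fs → f [] ≤ t [] → Linked _≻_ (f ∷ fs) → ∑hits h t fs ≡ 0
  no-hit h t f []       f≤t fs≻         = refl
  no-hit h t f (g ∷ fs) f≤t (f≻g ∷ fs≻) = cong₂ _+_
    (hit-≢ h t g (<⇒≢ g<t)) (no-hit h t g fs (<⇒≤ g<t) fs≻)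
    where
    g<t : g [] < t []
    g<t = <-≤-trans (f≻g []) f≤t

  -- On a cube with a single point a strictly decreasing list takes the target value at most once:
  -- before that it is above, and afterwards, by `no-hit`, below.
  one-hit : ∀ h t (fs : List (Vec Bool 0 → ℕ)) → Linked _≻_ fs → ∑hits h t fs ≤ L 0 (List.length fs) * h []
  one-hit h t []       fs≻ = z≤n
  one-hit h t (f ∷ fs) fs≻ with f [] ≟ t []
  ... | yes f≡t = ≤-reflexive (cong₂ _+_ (hit-≡ h t f f≡t) (no-hit h t f fs (≤-reflexive f≡t) fs≻))
  ... | no  f≢t = begin
    hits h t f + ∑hits h t fs      ≡⟨ cong (_+ ∑hits h t fs) (hit-≢ h t f f≢t) ⟩
    ∑hits h t fs                   ≤⟨ one-hit h t fs (Linked.tail fs≻) ⟩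
    L 0 (List.length fs) * h []    ≤⟨ *-monoˡ-≤ (h []) (bounded (List.length fs)) ⟩
    1 * h []                       ∎
    where
    open ≤-Reasoning
    bounded : ∀ k → L 0 k ≤ 1
    bounded zero    = z≤n
    bounded (suc k) = ≤-refl

-- Sperner's theorem by symmetric chains: for a masked bit, the chain f₁ ≻ … ≻ fₖ
-- splits into the chains f₁(1·) ≻ f₁(0·) ≻ … ≻ fₖ(0·) and f₂(1·) ≻ … ≻ fₖ(1·).
chain-bound : ∀ (M : Vec Bool n) h t → Invariant M h → Invariant M t →
              ∀ fs {k} → List.length fs ≡ k → All (Increasing M) fs → Linked _≻_ fs →
              2 ^ ones M * ∑hits h t fs ≤ L (ones M) k * ∑ᵛ n h
chain-bound [] h t hᵢ tᵢ fs refl fs↑ fs≻ = ≤-trans (≤-reflexive (+-identityʳ _)) (one-hit h t fs fs≻)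
chain-bound {suc n} (false ∷ M) h t hᵢ tᵢ fs {k} refl fs↑ fs≻ = begin
  P * ∑hits h t fs                    ≡⟨ cong (P *_) (∑hits-restrict h t fs) ⟩
  P * (parts false + parts true)      ≡⟨ *-distribˡ-+ P (parts false) (parts true) ⟩
  P * parts false + P * parts true    ≤⟨ +-mono-≤ (half false) (half true) ⟩
  L N k * H false + L N k * H true    ≡⟨ *-distribˡ-+ (L N k) (H false) (H true) ⟨
  L N k * ∑ᵛ (suc n) h                ∎
  where
  open ≤-Reasoning
  N = ones M
  P = 2 ^ N
  parts H : Bool → ℕ
  parts b = ∑hits (restrict b h) (restrict b t) (List.map (restrict b) fs)
  H b = ∑ᵛ n (restrict b h)
  half : ∀ b → P * parts b ≤ L N k * H b
  half b = chain-bound M (restrict b h) (restrict b t) (λ p p′ → hᵢ _ _ ∘ there) (λ p p′ → tᵢ _ _ ∘ there)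
    (List.map (restrict b) fs) (length-map (restrict b) fs) (restricts-increasing b fs↑) (restricts-≻ b fs≻)
chain-bound (true ∷ M) h t hᵢ tᵢ [] refl fs↑ fs≻ = ≤-trans (≤-reflexive (*-zeroʳ (2 * 2 ^ ones M))) z≤n
chain-bound {suc n} (true ∷ M) h t hᵢ tᵢ (f ∷ fs) refl (f↑ ∷ fs↑) fs≻ = begin
  2 * P * ∑hits h t (f ∷ fs)                  ≡⟨ cong (2 * P *_) (∑hits-restrict h t (f ∷ fs)) ⟩
  2 * P * (a + b + ∑hits (restrict true h) (restrict true t) (List.map (restrict true) (f ∷ fs)))
    -- Invariance under raising the head bit gives both halves the same weight and the same target.
    -- Only therefore may functions from different halves be placed in one chain.
    ≡⟨ cong (λ x → 2 * P * (a + b + x))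
         (∑hits-cong (λ p → sym (h₀≗h₁ p)) (λ p → sym (tᵢ _ _ here)) (List.map (restrict true) (f ∷ fs))) ⟩
  2 * P * (a + b + (c + d))                   ≡⟨ regroup P a b c d ⟩
  2 * (P * (c + (a + b)) + P * d)             ≤⟨ *-monoʳ-≤ 2 (+-mono-≤ long short) ⟩
  2 * (L N (2 + k) * H + L N k * H)           ≡⟨ double (L N (2 + k)) (L N k) H ⟩
  (L N (2 + k) + L N k) * (H + H)
    ≡⟨ cong (λ x → L (suc N) (suc k) * (H + x)) (∑ᵛ-cong n h₀≗h₁) ⟩
  L (suc N) (suc k) * ∑ᵛ (suc n) h            ∎
  where
  open ≤-Reasoning
  N = ones M
  P = 2 ^ N
  k = List.length fs
  h₀ = restrict false h
  t₀ = restrict false t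
  h₀≗h₁ : h₀ ≗ restrict true h
  h₀≗h₁ p = hᵢ _ _ here
  H = ∑ᵛ n h₀
  a = hits h₀ t₀ (restrict false f)
  b = ∑hits h₀ t₀ (List.map (restrict false) fs)
  c = hits h₀ t₀ (restrict true f)
  d = ∑hits h₀ t₀ (List.map (restrict true) fs)
  h₀ᵢ : Invariant M h₀
  h₀ᵢ p p′ = hᵢ _ _ ∘ there
  t₀ᵢ : Invariant M t₀
  t₀ᵢ p p′ = tᵢ _ _ ∘ there
  long : P * (c + (a + b)) ≤ L N (2 + k) * H
  long = chain-bound M h₀ t₀ h₀ᵢ t₀ᵢ (restrict true f ∷ List.map (restrict false) (f ∷ fs))
    (cong (2 +_) (length-map (restrict false) fs))
    ((λ p p′ → f↑ _ _ ∘ there) ∷ restricts-increasing false (f↑ ∷ fs↑))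
    ((λ p → f↑ _ _ here) ∷ restricts-≻ false fs≻)
  short : P * d ≤ L N k * H
  short = chain-bound M h₀ t₀ h₀ᵢ t₀ᵢ (List.map (restrict true) fs) (length-map (restrict true) fs)
    (restricts-increasing true fs↑) (restricts-≻ true (Linked.tail fs≻))
  regroup : ∀ p a b c d → 2 * p * (a + b + (c + d)) ≡ 2 * (p * (c + (a + b)) + p * d)
  regroup = solve-∀
  double : ∀ x y h → 2 * (x * h + y * h) ≡ (x + y) * (h + h)
  double = solve-∀

-- A chain of length one. For fixed unmasked bits the solutions of `f p ≡ t p` form an antichain in
-- the masked bits, so the middle binomial coefficient bounds their number.
sperner : ∀ (M : Vec Bool n) h t f → Invariant M h → Invariant M t → Increasing M f →
          2 ^ ones M * hits h t f ≤ L (ones M) 1 * ∑ᵛ n h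
sperner {n} M h t f hᵢ tᵢ f↑ = subst (λ x → 2 ^ ones M * x ≤ L (ones M) 1 * ∑ᵛ n h)
    (+-identityʳ (hits h t f))
  (chain-bound M h t hᵢ tᵢ (f ∷ []) refl (f↑ ∷ []) [-])

-- A factor `2 / s` on top of the weight `h`. Since `h` may be the indicator of an earlier event,
-- bounds obtained from different masks multiply. The 4 allows `s` to be the number of vertices of a
-- clique whose edges are masked.
sperner-scaled : ∀ (M : Vec Bool n) h t f s → s * s ≤ 4 * suc (ones M) →
                 Invariant M h → Invariant M t → Increasing M f →
                 s * hits h t f ≤ 2 * ∑ᵛ n h
sperner-scaled {n} M h t f s s²≤ hᵢ tᵢ f↑ = *-cancelˡ-≤ (2 ^ N) {{m^n≢0 2 N}} (begin
  2 ^ N * (s * hits h t f)     ≡⟨ regroup₁ (2 ^ N) s _ ⟩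
  s * (2 ^ N * hits h t f)     ≤⟨ *-monoʳ-≤ s (sperner M h t f hᵢ tᵢ f↑) ⟩
  s * (L N 1 * ∑ᵛ n h)         ≡⟨ regroup₂ s (L N 1) _ ⟩
  L N 1 * s * ∑ᵛ n h           ≤⟨ *-monoˡ-≤ (∑ᵛ n h) (L-one-scaled N s s²≤) ⟩
  2 * 2 ^ N * ∑ᵛ n h           ≡⟨ regroup₃ (2 ^ N) _ ⟩
  2 ^ N * (2 * ∑ᵛ n h)         ∎)
  where
  open ≤-Reasoning
  N = ones M
  regroup₁ : ∀ a b c → a * (b * c) ≡ b * (a * c)
  regroup₁ = solve-∀
  regroup₂ : ∀ a b c → a * (b * c) ≡ b * a * c
  regroup₂ = solve-∀
  regroup₃ : ∀ a b → 2 * a * b ≡ a * (2 * b)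
  regroup₃ = solve-∀

-- Sums over graphs

∑ˡ : ∀ {a} {A : Set a} → List A → (A → ℕ) → ℕ
∑ˡ xs f = sumˡ (List.map f xs)

module _ {a} {A : Set a} where

  ∑ˡ-cong : ∀ {f g : A → ℕ} → f ≗ g → ∀ xs → ∑ˡ xs f ≡ ∑ˡ xs g
  ∑ˡ-cong f≗g xs = cong sumˡ (map-cong f≗g xs)

  length-filter-∑ˡ : ∀ {p} {P : A → Set p} (P? : Decidable P) xs → length (filter P? xs) ≡ ∑ˡ xs λ x →
      [ P? x ]
  length-filter-∑ˡ P? []       = refl
  length-filter-∑ˡ P? (x ∷ xs) with does (P? x)
  ... | true  = cong suc (length-filter-∑ˡ P? xs)
  ... | false = length-filter-∑ˡ P? xs

  length-∑ˡ : ∀ (xs : List A) → length xs ≡ ∑ˡ xs λ _ → 1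
  length-∑ˡ []       = refl
  length-∑ˡ (x ∷ xs) = cong suc (length-∑ˡ xs)

  ∑ˡ-*ˡ : ∀ c (f : A → ℕ) xs → ∑ˡ xs (λ x → c * f x) ≡ c * ∑ˡ xs f
  ∑ˡ-*ˡ c f []       = sym (*-zeroʳ c)
  ∑ˡ-*ˡ c f (x ∷ xs) = trans (cong (c * f x +_) (∑ˡ-*ˡ c f xs)) (sym (*-distribˡ-+ c (f x) _))

∑ˡ-× : ∀ {a b c} {A : Set a} {B : Set b} {C : Set c} (g : A → B → C) xs ys (f : C → ℕ) →
       ∑ˡ (cartesianProductWith g xs ys) f ≡ ∑ˡ xs λ x → ∑ˡ ys λ y → f (g x y)
∑ˡ-× g []       ys f = refl
∑ˡ-× g (x ∷ xs) ys f = begin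
  ∑ˡ (List.map (g x) ys List.++ cartesianProductWith g xs ys) f
    ≡⟨ cong sumˡ (map-++ f (List.map (g x) ys) _) ⟩
  sumˡ (List.map f (List.map (g x) ys) List.++ List.map f (cartesianProductWith g xs ys))
    ≡⟨ sum-++ (List.map f (List.map (g x) ys)) _ ⟩
  ∑ˡ (List.map (g x) ys) f + ∑ˡ (cartesianProductWith g xs ys) f
    ≡⟨ cong₂ _+_ (cong sumˡ (sym (map-∘ ys))) (∑ˡ-× g xs ys f) ⟩
  ∑ˡ ys (f ∘ g x) + ∑ˡ xs (λ x → ∑ˡ ys λ y → f (g x y))           ∎
  where open ≡-Reasoning

∑ˡ-allFin : ∀ n (f : Fin n → ℕ) → ∑ˡ (allFin n) f ≡ sum f
∑ˡ-allFin n f = trans (cong sumˡ (map-tabulate (λ i → i) f)) (go n f)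
  where
  go : ∀ n (f : Fin n → ℕ) → sumˡ (List.tabulate f) ≡ sum f
  go zero    f = refl
  go (suc n) f = cong (f zero +_) (go n (f ∘ suc))

∑ˡ-bools : ∀ n (f : Vec Bool n → ℕ) → ∑ˡ (vectors bools n) f ≡ ∑ᵛ n f
∑ˡ-bools zero    f = +-identityʳ _
∑ˡ-bools (suc n) f = trans (∑ˡ-× _∷_ bools (vectors bools n) f)
  (cong₂ _+_ (∑ˡ-bools n _) (trans (+-identityʳ _) (∑ˡ-bools n _)))

-- Graphs as bit vectors

edges : ℕ → ℕ
edges zero    = 0
edges (suc n) = n + edges n

flatten : Graph n → Vec Bool (edges n)
flatten []        = []
flatten (row ∷ G) = row ++ flatten G

unflatten : ∀ n → Vec Bool (edges n) → Graph n
unflatten zero    p = []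
unflatten (suc n) p = take n p ∷ unflatten n (drop n p)

take-++ : ∀ {m n} (p : Vec Bool m) (q : Vec Bool n) → take m (p ++ q) ≡ p
take-++ []      q = refl
take-++ (b ∷ p) q = cong (b ∷_) (take-++ p q)

drop-++ : ∀ {m n} (p : Vec Bool m) (q : Vec Bool n) → drop m (p ++ q) ≡ q
drop-++ []      q = refl
drop-++ (b ∷ p) q = drop-++ p q

-- A sum over a cube by definition, so that Sperner's theorem applies directly; `∑ˡ-graphs` links it
-- to the list of graphs that defines the probability.
∑ᴳ : ∀ n → (Graph n → ℕ) → ℕ
∑ᴳ n f = ∑ᵛ (edges n) (f ∘ unflatten n)

∑ᴳ-suc : ∀ n (f : Graph (suc n) → ℕ) → ∑ᴳ (suc n) f ≡ ∑ᵛ n λ row → ∑ᴳ n λ G → f (row ∷ G)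
∑ᴳ-suc n f = trans (∑ᵛ-++ n (edges n) _) (∑ᵛ-cong n λ p → ∑ᵛ-cong (edges n) λ q →
  cong₂ (λ row r → f (row ∷ unflatten n r)) (take-++ p q) (drop-++ p q))

∑ˡ-graphs : ∀ n (f : Graph n → ℕ) → ∑ˡ (graphs n) f ≡ ∑ᴳ n f
∑ˡ-graphs zero    f = +-identityʳ _
∑ˡ-graphs (suc n) f = begin
  ∑ˡ (graphs (suc n)) f
    ≡⟨ ∑ˡ-× _∷_ (vectors bools n) (graphs n) f ⟩
  ∑ˡ (vectors bools n) (λ row → ∑ˡ (graphs n) λ G → f (row ∷ G))
    ≡⟨ ∑ˡ-cong (λ row → ∑ˡ-graphs n λ G → f (row ∷ G)) (vectors bools n) ⟩
  ∑ˡ (vectors bools n) (λ row → ∑ᴳ n λ G → f (row ∷ G))             ≡⟨ ∑ˡ-bools n _ ⟩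
  ∑ᵛ n (λ row → ∑ᴳ n λ G → f (row ∷ G))                             ≡⟨ ∑ᴳ-suc n f ⟨
  ∑ᴳ (suc n) f                                                      ∎
  where open ≡-Reasoning

-- What a raise means for any family of bits. In a graph one raised bit changes two ordered pairs of
-- vertices, so uniqueness of the changed index is not recorded, only a witness and monotonicity.
record _⊏[_]_ {I : Set} (f : I → Bool) (M : I → Bool) (g : I → Bool) : Set where
  field
    raised    : ∃[ i ] (M i ≡ true × f i ≡ false × g i ≡ true)
    unchanged : ∀ i → M i ≡ false → f i ≡ g i
    monotone  : ∀ i → ⟦ f i ⟧ ≤ ⟦ g i ⟧

open _⊏[_]_ public

raise-lookup : ∀ {M p p′ : Vec Bool n} → Raise M p p′ → lookup p ⊏[ lookup M ] lookup p′
raise-lookup here .raised    = zero , refl , refl , refl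
raise-lookup here .unchanged (suc i) _ = refl
raise-lookup here .monotone  zero    = z≤n
raise-lookup here .monotone  (suc i) = ≤-refl
raise-lookup (there p⊏p′) .raised = map suc (λ x → x) (raise-lookup p⊏p′ .raised)
raise-lookup (there p⊏p′) .unchanged zero    _  = refl
raise-lookup (there p⊏p′) .unchanged (suc i) eq = raise-lookup p⊏p′ .unchanged i eq
raise-lookup (there p⊏p′) .monotone zero    = ≤-refl
raise-lookup (there p⊏p′) .monotone (suc i) = raise-lookup p⊏p′ .monotone i

raise-++ : ∀ {m n} (M : Vec Bool m) {N : Vec Bool n} {p p′} → Raise (M ++ N) p p′ →
           (Raise M (take m p) (take m p′) × drop m p ≡ drop m p′) ⊎
           (take m p ≡ take m p′ × Raise N (drop m p) (drop m p′))
raise-++ []      r    = inj₂ (refl , r)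
raise-++ (_ ∷ M) here = inj₁ (here , refl)
raise-++ (_ ∷ M) (there {b = b} r) with raise-++ M r
... | inj₁ (r′ , eq) = inj₁ (there r′ , eq)
... | inj₂ (eq , r′) = inj₂ (cong (b ∷_) eq , r′)

adj₂ : Graph n → Fin n × Fin n → Bool
adj₂ G (x , y) = adj G x y

raise-adj : ∀ (M : Graph n) {p p′} → Raise (flatten M) p p′ →
            adj₂ (unflatten n p) ⊏[ adj₂ M ] adj₂ (unflatten n p′)
raise-adj {suc n} (row ∷ M) {p} {p′} r with raise-++ row r
... | inj₁ (r′ , eq) = λ where
    .raised → let i , props = rows .raised in (zero , suc i) , props
    .unchanged (zero  , zero)  _ → refl
    .unchanged (zero  , suc y) m → rows .unchanged y m
    .unchanged (suc x , zero)  m → rows .unchanged x m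
    .unchanged (suc x , suc y) _ → cong (λ q → adj (unflatten n q) x y) eq
    .monotone (zero  , zero)  → ≤-refl
    .monotone (zero  , suc y) → rows .monotone y
    .monotone (suc x , zero)  → rows .monotone x
    .monotone (suc x , suc y) → ≤-reflexive (cong (λ q → ⟦ adj (unflatten n q) x y ⟧) eq)
  where
  rows : lookup (take n p) ⊏[ lookup row ] lookup (take n p′)
  rows = raise-lookup r′
... | inj₂ (eq , r′) = λ where
    .raised → let (x , y) , props = rest .raised in (suc x , suc y) , props
    .unchanged (zero  , zero)  _ → refl
    .unchanged (zero  , suc y) _ → cong (λ q → lookup q y) eq
    .unchanged (suc x , zero)  _ → cong (λ q → lookup q x) eq
    .unchanged (suc x , suc y) m → rest .unchanged (x , y) m
    .monotone (zero  , zero)  → ≤-refl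
    .monotone (zero  , suc y) → ≤-reflexive (cong (λ q → ⟦ lookup q y ⟧) eq)
    .monotone (suc x , zero)  → ≤-reflexive (cong (λ q → ⟦ lookup q x ⟧) eq)
    .monotone (suc x , suc y) → rest .monotone (x , y)
  where
  rest : adj₂ (unflatten n (drop n p)) ⊏[ adj₂ M ] adj₂ (unflatten n (drop n p′))
  rest = raise-adj M r′

ones-++ : ∀ {m n} (p : Vec Bool m) (q : Vec Bool n) → ones (p ++ q) ≡ ones p + ones q
ones-++ []      q = refl
ones-++ (b ∷ p) q = trans (cong (⟦ b ⟧ +_) (ones-++ p q)) (sym (+-assoc ⟦ b ⟧ _ _))

ones-sum : ∀ (p : Vec Bool n) → sum (λ i → ⟦ lookup p i ⟧) ≡ ones p
ones-sum []      = refl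
ones-sum (b ∷ p) = cong (⟦ b ⟧ +_) (ones-sum p)

handshake : ∀ (G : Graph n) → sum (λ x → sum λ y → ⟦ adj G x y ⟧) ≡ 2 * ones (flatten G)
handshake []        = refl
handshake (row ∷ G) = begin
  sum (λ y → ⟦ lookup row y ⟧) + sum (λ x → ⟦ lookup row x ⟧ + sum λ y → ⟦ adj G x y ⟧)
    ≡⟨ cong₂ _+_ (ones-sum row) (∑-distrib-+ (λ x → ⟦ lookup row x ⟧) (λ x → sum λ y → ⟦ adj G x y ⟧)) ⟩
  ones row + (sum (λ x → ⟦ lookup row x ⟧) + sum (λ x → sum λ y → ⟦ adj G x y ⟧))
    ≡⟨ cong (ones row +_) (cong₂ _+_ (ones-sum row) (handshake G)) ⟩
  ones row + (ones row + 2 * ones (flatten G))  ≡⟨ regroup (ones row) _ ⟩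
  2 * (ones row + ones (flatten G))             ≡⟨ cong (2 *_) (ones-++ row (flatten G)) ⟨
  2 * ones (row ++ flatten G)                   ∎
  where
  open ≡-Reasoning
  regroup : ∀ a b → a + (a + 2 * b) ≡ 2 * (a + b)
  regroup = solve-∀

-- Invariance under relabelling

relabel : Permutation′ n → Graph n → Graph n
relabel π G = proj₁ (adj-surjective (λ x y → adj G (π ⟨$⟩ʳ x) (π ⟨$⟩ʳ y)) (λ x → adj-irrefl G _)
    (λ x y → adj-sym G _ _))

adj-relabel : ∀ π (G : Graph n) x y → adj (relabel π G) x y ≡ adj G (π ⟨$⟩ʳ x) (π ⟨$⟩ʳ y)
adj-relabel π G = proj₂
    (adj-surjective (λ x y → adj G (π ⟨$⟩ʳ x) (π ⟨$⟩ʳ y)) (λ x → adj-irrefl G _) (λ x y → adj-sym G _ _))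

relabel-inverse : ∀ (π : Permutation′ n) G → relabel π (relabel (Perm.flip π) G) ≡ G
relabel-inverse π G = adj-injective _ _ λ x y → trans (adj-relabel π (relabel (Perm.flip π) G) x y)
  (trans (adj-relabel (Perm.flip π) G _ _) (cong₂ (adj G) (Perm.inverseˡ π) (Perm.inverseˡ π)))

-- Relabelling is injective and has an inverse, so it maps the duplicate-free list of all graphs to
-- a duplicate-free list with the same members, that is, to a permutation of it.
∑ᴳ-relabel : ∀ (π : Permutation′ n) f → ∑ᴳ n (f ∘ relabel π) ≡ ∑ᴳ n f
∑ᴳ-relabel {n} π f = begin
  ∑ᴳ n (f ∘ relabel π)                      ≡⟨ ∑ˡ-graphs n _ ⟨
  ∑ˡ (graphs n) (f ∘ relabel π)             ≡⟨ cong sumˡ (map-∘ (graphs n)) ⟩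
  ∑ˡ (List.map (relabel π) (graphs n)) f    ≡⟨ sum-↭ (↭.map⁺ f relabelled↭) ⟩
  ∑ˡ (graphs n) f                           ≡⟨ ∑ˡ-graphs n f ⟩
  ∑ᴳ n f                                    ∎
  where
  open ≡-Reasoning
  relabel-injective : ∀ {G H} → relabel π G ≡ relabel π H → G ≡ H
  relabel-injective {G} {H} eq = trans (sym (relabel-inverse (Perm.flip π) G))
    (trans (cong (relabel (Perm.flip π)) eq) (relabel-inverse (Perm.flip π) H))
  relabelled↭ : List.map (relabel π) (graphs n) ↭ graphs n
  relabelled↭ = ∼bag⇒↭ (unique∧set⇒bag
    (Unique.map⁺ relabel-injective (graphs-unique n)) (graphs-unique n)
    (λ {G} → mk⇔ (λ _ → ∈-graphs G)
      (λ _ → subst (_∈ _) (relabel-inverse π G) (∈-map⁺ (relabel π) (∈-graphs (relabel (Perm.flip π) G))))))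

-- Closed walks

sum-zero : ∀ (f : Fin n → ℕ) → (∀ i → f i ≡ 0) → sum f ≡ 0
sum-zero {n} f f≡0 = trans (sum-cong-≗ f≡0) (sum-replicate-zero n)

sum-≟ : ∀ (f : Fin n → ℕ) v → sum (λ x → f x * [ x ≟ᶠ v ]) ≡ f v
sum-≟ f zero    = trans
  (cong₂ _+_ (*-identityʳ (f zero)) (sum-zero _ (λ x → *-zeroʳ (f (suc x)))))
  (+-identityʳ _)
sum-≟ f (suc v) = cong₂ _+_ (*-zeroʳ (f zero)) (trans (sum-cong-≗ step) (sum-≟ (f ∘ suc) v))
  where
  step : ∀ x → f (suc x) * [ suc x ≟ᶠ suc v ] ≡ f (suc x) * [ x ≟ᶠ v ]
  step x = cong (f (suc x) *_) ([]-cong (suc x ≟ᶠ suc v) (x ≟ᶠ v) (λ { refl → refl }) (λ { refl → refl }))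

A : Graph n → Fin n → Fin n → ℕ
A G x y = ⟦ adj G x y ⟧

A-sym : ∀ (G : Graph n) x y → A G x y ≡ A G y x
A-sym G x y = cong ⟦_⟧ (adj-sym G x y)

-- The entries of the `k`-th power of the adjacency matrix. Free endpoints make the induction on the
-- length possible, which closed walks alone would not.
walks : Graph n → ℕ → Fin n → Fin n → ℕ
walks G zero    x y = [ x ≟ᶠ y ]
walks G (suc k) x y = sum λ z → A G x z * walks G k z y

[]-× : ∀ {p q} {P : Set p} {Q : Set q} (P? : Dec P) (Q? : Dec Q) → [ P? ×-dec Q? ] ≡ [ P? ] * [ Q? ]
[]-× (yes _) Q? = sym (+-identityʳ _)
[]-× (no _)  Q? = refl

module _ (G : Graph n) where

  private
    V : List (Fin n)
    V = allFin n

    linkedᴳ? : ∀ {k} (w : Vec (Fin n) k) → Dec (Linkedᵛ.Linked (Adj G) w)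
    linkedᴳ? = linked? (λ x y → T? (adj G x y))

    extends? : ∀ {k} y (w : Vec (Fin n) (suc k)) → Dec (last w ≡ y × Linkedᵛ.Linked (Adj G) w)
    extends? y w = (last w ≟ᶠ y) ×-dec linkedᴳ? w

    [T?] : ∀ b → [ T? b ] ≡ ⟦ b ⟧
    [T?] false = refl
    [T?] true  = refl

    -- The second vertex of the walk is written as a sum over all `z` with a Kronecker delta. After
    -- exchanging sums, the delta is the restriction on the head in `count-walks`, and the recursion
    -- of `walks` appears.
    extend : ∀ {k} x y (w : Vec (Fin n) (suc k)) →
             [ extends? y (x ∷ w) ] ≡ sum λ z → A G x z * ([ head w ≟ᶠ z ] * [ extends? y w ])
    extend x y w@(z ∷ w′) = begin
      [ extends? y (x ∷ w) ]
        ≡⟨ []-cong (extends? y (x ∷ w)) (T? (adj G x z) ×-dec extends? y w)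
             (λ { (l , a ∷ as) → a , l , as }) (λ { (a , l , as) → l , a ∷ as }) ⟩
      [ T? (adj G x z) ×-dec extends? y w ]      ≡⟨ []-× (T? (adj G x z)) (extends? y w) ⟩
      [ T? (adj G x z) ] * e                     ≡⟨ cong (_* e) ([T?] (adj G x z)) ⟩
      A G x z * e                                ≡⟨ sum-≟ (λ z → A G x z * e) z ⟨
      sum (λ u → A G x u * e * [ u ≟ᶠ z ])
        ≡⟨ sum-cong-≗ (λ u → trans (regroup (A G x u) e _)
             (cong (λ d → A G x u * (d * e)) ([]-cong (u ≟ᶠ z) (z ≟ᶠ u) sym sym))) ⟩
      sum (λ u → A G x u * ([ z ≟ᶠ u ] * e))     ∎
      where
      open ≡-Reasoning
      e = [ extends? y w ]
      regroup : ∀ a b c → a * b * c ≡ a * (c * b)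
      regroup = solve-∀

    ∑ˡ-sum : ∀ {B : Set} (xs : List B) (f : B → Fin n → ℕ) → ∑ˡ xs (λ w → sum (f w)) ≡ sum λ z →
        ∑ˡ xs λ w → f w z
    ∑ˡ-sum []       f = sym (sum-zero {n} (λ _ → 0) (λ _ → refl))
    ∑ˡ-sum (w ∷ xs) f = trans (cong (sum (f w) +_) (∑ˡ-sum xs f)) (sym (∑-distrib-+ (f w) _))

    count-walks : ∀ k x y → ∑ˡ (vectors V (suc k))
        (λ w → [ head w ≟ᶠ x ] * [ extends? y w ]) ≡ walks G k x y
    count-walks k x y = begin
      ∑ˡ (vectors V (suc k)) (λ w → [ head w ≟ᶠ x ] * [ extends? y w ])
        ≡⟨ ∑ˡ-× _∷_ V (vectors V k) _ ⟩
      ∑ˡ V (λ v → ∑ˡ (vectors V k) λ w → [ v ≟ᶠ x ] * [ extends? y (v ∷ w) ])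
        ≡⟨ ∑ˡ-cong (λ v → trans (∑ˡ-*ˡ [ v ≟ᶠ x ] (λ w → [ extends? y (v ∷ w) ]) (vectors V k))
             (*-comm [ v ≟ᶠ x ] _)) V ⟩
      ∑ˡ V (λ v → (∑ˡ (vectors V k) λ w → [ extends? y (v ∷ w) ]) * [ v ≟ᶠ x ])
        ≡⟨ ∑ˡ-allFin n _ ⟩
      sum (λ v → (∑ˡ (vectors V k) λ w → [ extends? y (v ∷ w) ]) * [ v ≟ᶠ x ])
        ≡⟨ sum-≟ (λ v → ∑ˡ (vectors V k) λ w → [ extends? y (v ∷ w) ]) x ⟩
      ∑ˡ (vectors V k) (λ w → [ extends? y (x ∷ w) ])
        ≡⟨ tails k ⟩
      walks G k x y ∎
      where
      open ≡-Reasoning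
      tails : ∀ k → ∑ˡ (vectors V k) (λ w → [ extends? y (x ∷ w) ]) ≡ walks G k x y
      tails zero    = trans (+-identityʳ _) ([]-cong (extends? y (x ∷ [])) (x ≟ᶠ y) proj₁ (λ eq → eq , [-]))
      tails (suc k) = begin
        ∑ˡ (vectors V (suc k)) (λ w → [ extends? y (x ∷ w) ])  ≡⟨ ∑ˡ-cong (extend x y) (vectors V (suc k)) ⟩
        ∑ˡ (vectors V (suc k)) (λ w → sum λ z → A G x z * ([ head w ≟ᶠ z ] * [ extends? y w ]))
          ≡⟨ ∑ˡ-sum (vectors V (suc k)) (λ w z → A G x z * ([ head w ≟ᶠ z ] * [ extends? y w ])) ⟩
        sum (λ z → ∑ˡ (vectors V (suc k)) λ w → A G x z * ([ head w ≟ᶠ z ] * [ extends? y w ]))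
          ≡⟨ sum-cong-≗ (λ z → trans
               (∑ˡ-*ˡ (A G x z) (λ w → [ head w ≟ᶠ z ] * [ extends? y w ]) (vectors V (suc k)))
                   (cong (A G x z *_) (count-walks k z y))) ⟩
        sum (λ z → A G x z * walks G k z y) ∎

  r≡walks : ∀ k v → r G k v ≡ walks G k v v
  r≡walks k v = begin
    r G k v
      ≡⟨ length-filter-∑ˡ (isClosedWalk? G k v) (vectors V (suc k)) ⟩
    ∑ˡ (vectors V (suc k)) (λ w → [ isClosedWalk? G k v w ])
      ≡⟨ ∑ˡ-cong (λ w → []-× (head w ≟ᶠ v) (extends? v w)) (vectors V (suc k)) ⟩
    ∑ˡ (vectors V (suc k)) (λ w → [ head w ≟ᶠ v ] * [ extends? v w ]) ≡⟨ count-walks k v v ⟩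
    walks G k v v                                               ∎
    where open ≡-Reasoning

walks-relabel : ∀ (π : Permutation′ n) G k x y → walks (relabel π G) k x y ≡ walks G k (π ⟨$⟩ʳ x) (π ⟨$⟩ʳ y)
walks-relabel π G zero    x y = []-cong (x ≟ᶠ y) ((π ⟨$⟩ʳ x) ≟ᶠ (π ⟨$⟩ʳ y)) (cong (π ⟨$⟩ʳ_))
  (λ eq → trans (sym (Perm.inverseˡ π)) (trans (cong (π ⟨$⟩ˡ_) eq) (Perm.inverseˡ π)))
walks-relabel π G (suc k) x y = trans
  (sum-cong-≗ λ z → cong₂ _*_ (cong ⟦_⟧ (adj-relabel π G x z)) (walks-relabel π G k z y))
  (sym (sum-permute (λ z → A G (π ⟨$⟩ʳ x) z * walks G k z (π ⟨$⟩ʳ y)) π))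

r-relabel : ∀ (π : Permutation′ n) G k v → r (relabel π G) k v ≡ r G k (π ⟨$⟩ʳ v)
r-relabel π G k v = trans (r≡walks (relabel π G) k v)
    (trans (walks-relabel π G k v v) (sym (r≡walks G k _)))

-- For `u` the row of the base vertex these are the quadratic form of `B` at `u` and the squared
-- norm of `u` times `B`. The row is an argument of its own so that it can stay fixed while other
-- edges change.
triangles squares : (U : Fin n → ℕ) (B : Fin n → Fin n → ℕ) → ℕ
triangles U B = sum λ x → sum λ y → U x * B x y * U y
squares   U B = sum λ y → (sum λ x → U x * B x y) * (sum λ x → U x * B x y)

module _ (G : Graph n) (v : Fin n) where
  open ≡-Reasoning

  walks₁ : ∀ x → walks G 1 x v ≡ A G v x
  walks₁ x = trans (sum-≟ (A G x) v) (A-sym G x v)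

  walks₂ : ∀ x → walks G 2 x v ≡ sum λ y → A G v y * A G y x
  walks₂ x = sum-cong-≗ λ y → trans (cong₂ _*_ (A-sym G x y) (walks₁ y)) (*-comm (A G y x) (A G v y))

  r₂ : r G 2 v ≡ sum (A G v)
  r₂ = trans (r≡walks G 2 v)
      (trans (walks₂ v) (sum-cong-≗ λ y → trans (cong (A G v y *_) (A-sym G y v)) (idem (adj G v y))))
    where
    idem : ∀ b → ⟦ b ⟧ * ⟦ b ⟧ ≡ ⟦ b ⟧
    idem false = refl
    idem true  = refl

  r₃ : r G 3 v ≡ triangles (A G v) (A G)
  r₃ = trans (r≡walks G 3 v) (sum-cong-≗ λ x → trans
    (*-distribˡ-sum (A G v x) (λ y → A G x y * walks G 1 y v))
    (sum-cong-≗ λ y → trans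
      (cong (λ w → A G v x * (A G x y * w)) (walks₁ y))
      (sym (*-assoc (A G v x) (A G x y) (A G v y)))))

  -- Cut a closed 4-walk at its middle vertex `y`: both halves are 2-walks between `v` and `y`,
  -- equal in number by symmetry.
  r₄ : r G 4 v ≡ squares (A G v) (A G)
  r₄ = begin
    r G 4 v                                                       ≡⟨ r≡walks G 4 v ⟩
    sum (λ x → A G v x * sum λ y → A G x y * walks G 2 y v)
      ≡⟨ sum-cong-≗ (λ x → trans (*-distribˡ-sum (A G v x) (λ y → A G x y * walks G 2 y v))
           (sum-cong-≗ λ y → sym (*-assoc (A G v x) (A G x y) (walks G 2 y v)))) ⟩
    sum (λ x → sum λ y → A G v x * A G x y * walks G 2 y v)
      ≡⟨ ∑-comm (λ x y → A G v x * A G x y * walks G 2 y v) ⟩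
    sum (λ y → sum λ x → A G v x * A G x y * walks G 2 y v)
      ≡⟨ sum-cong-≗ (λ y → trans (sym (*-distribʳ-sum (walks G 2 y v) (λ x → A G v x * A G x y)))
           (cong ((sum λ x → A G v x * A G x y) *_) (walks₂ y))) ⟩
    squares (A G v) (A G)                                         ∎

-- Graphs with two prescribed rows

sum-mono-≤ : ∀ {f g : Fin n → ℕ} → (∀ i → f i ≤ g i) → sum f ≤ sum g
sum-mono-≤ {zero}  f≤g = z≤n
sum-mono-≤ {suc n} f≤g = +-mono-≤ (f≤g zero) (sum-mono-≤ (f≤g ∘ suc))

sum-mono-< : ∀ {f g : Fin n → ℕ} → (∀ i → f i ≤ g i) → ∀ i → f i < g i → sum f < sum g
sum-mono-< f≤g zero    f<g = +-mono-<-≤ f<g (sum-mono-≤ (f≤g ∘ suc))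
sum-mono-< f≤g (suc i) f<g = +-mono-≤-< (f≤g zero) (sum-mono-< (f≤g ∘ suc) i f<g)

triangles-cong : ∀ {U U′ : Fin n → ℕ} B B′ → U ≗ U′ → (∀ x y → U x * B x y * U y ≡ U x * B′ x y * U y) →
                 triangles U B ≡ triangles U′ B′
triangles-cong B B′ U≗U′ eq = sum-cong-≗ λ x → sum-cong-≗ λ y →
  trans (eq x y) (cong₂ (λ u v → u * B′ x y * v) (U≗U′ x) (U≗U′ y))

squares-cong : ∀ {U U′ : Fin n → ℕ} B B′ → U ≗ U′ → (∀ x y → U x * B x y ≡ U x * B′ x y) →
    squares U B ≡ squares U′ B′
squares-cong {n} B B′ U≗U′ eq = sum-cong-≗ {n} λ y → cong (λ s → s * s) (sum-cong-≗ λ x →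
  trans (eq x y) (cong (_* B′ x y) (U≗U′ x)))

module _ (U : Fin n → ℕ) {B B′ : Fin n → Fin n → ℕ} (B≤B′ : ∀ x y → B x y ≤ B′ x y) where

  triangles-mono-< : ∀ x y → U x ≡ 1 → U y ≡ 1 → B x y < B′ x y → triangles U B < triangles U B′
  triangles-mono-< x y Ux Uy B<B′ = sum-mono-< (λ x → sum-mono-≤ (step x)) x
    (sum-mono-< (step x) y (subst₂ (λ u v → u * B x y * v < u * B′ x y * v) (sym Ux) (sym Uy)
      (*-monoˡ-< 1 (*-monoʳ-< 1 B<B′))))
    where
    step : ∀ x y → U x * B x y * U y ≤ U x * B′ x y * U y
    step x y = *-monoˡ-≤ (U y) (*-monoʳ-≤ (U x) (B≤B′ x y))

  squares-mono-< : ∀ x y → U x ≡ 1 → B x y < B′ x y → squares U B < squares U B′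
  squares-mono-< x y Ux B<B′ = sum-mono-< (λ y → *-mono-≤ (col y) (col y)) y (*-mono-< col-< col-<)
    where
    step : ∀ y x → U x * B x y ≤ U x * B′ x y
    step y x = *-monoʳ-≤ (U x) (B≤B′ x y)
    col : ∀ y → sum (λ x → U x * B x y) ≤ sum (λ x → U x * B′ x y)
    col y = sum-mono-≤ (step y)
    col-< : sum (λ x → U x * B x y) < sum (λ x → U x * B′ x y)
    col-< = sum-mono-< (step y) x (subst (λ u → u * B x y < u * B′ x y) (sym Ux) (*-monoʳ-< 1 B<B′))

pairCount : (Bool → Bool → Bool) → Vec Bool n → Vec Bool n → ℕ
pairCount c p q = sum λ x → ⟦ c (lookup p x) (lookup q x) ⟧

onlyFirst neither : Bool → Bool → Bool
onlyFirst b c = b ∧ not c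
neither   b c = not b ∧ not c

∧-true : ∀ b {c} → b ∧ c ≡ true → b ≡ true × c ≡ true
∧-true true eq = refl , eq

∨-true : ∀ b {c} → b ∨ c ≡ true → b ≡ true ⊎ c ≡ true
∨-true true  eq = inj₁ refl
∨-true false eq = inj₂ eq

not-true : ∀ b → not b ≡ true → b ≡ false
not-true false eq = refl

module TwoRows {m : ℕ} (e : Bool) (p q : Vec Bool m) where

  extend : Graph m → Graph (2 + m)
  extend H = (e ∷ p) ∷ (q ∷ H)

  -- The rows of the vertices 0 and 1 in `extend H`, written without `H`, so that a change of `H`
  -- visibly leaves them alone.
  U V : Fin (2 + m) → ℕ
  U zero          = 0
  U (suc zero)    = ⟦ e ⟧
  U (suc (suc x)) = ⟦ lookup p x ⟧
  V zero          = ⟦ e ⟧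
  V (suc zero)    = 0
  V (suc (suc x)) = ⟦ lookup q x ⟧

  row₀ : ∀ H → A (extend H) zero ≗ U
  row₀ H zero          = refl
  row₀ H (suc zero)    = refl
  row₀ H (suc (suc x)) = refl

  row₁ : ∀ H → A (extend H) (suc zero) ≗ V
  row₁ H zero          = refl
  row₁ H (suc zero)    = refl
  row₁ H (suc (suc x)) = refl

  T₀ T₁ S₀ S₁ : Graph m → ℕ
  T₀ H = triangles U (A (extend H))
  T₁ H = triangles V (A (extend H))
  S₀ H = squares U (A (extend H))
  S₁ H = squares V (A (extend H))

  -- Outside the block of `H` every entry is determined by `e`, `p` and `q`, so a reflexive relation
  -- between two extensions needs a proof only inside that block.
  extend-rel : ∀ {H H′} (R : Fin (2 + m) → Fin (2 + m) → ℕ → ℕ → Set) → (∀ x y a → R x y a a) →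
               (∀ x y → R (suc (suc x)) (suc (suc y)) (A H x y) (A H′ x y)) →
               ∀ x y → R x y (A (extend H) x y) (A (extend H′) x y)
  extend-rel R R-refl R-H zero          zero          = R-refl _ _ _
  extend-rel R R-refl R-H zero          (suc zero)    = R-refl _ _ _
  extend-rel R R-refl R-H zero          (suc (suc y)) = R-refl _ _ _
  extend-rel R R-refl R-H (suc zero)    zero          = R-refl _ _ _
  extend-rel R R-refl R-H (suc zero)    (suc zero)    = R-refl _ _ _
  extend-rel R R-refl R-H (suc zero)    (suc (suc y)) = R-refl _ _ _
  extend-rel R R-refl R-H (suc (suc x)) zero          = R-refl _ _ _
  extend-rel R R-refl R-H (suc (suc x)) (suc zero)    = R-refl _ _ _
  extend-rel R R-refl R-H (suc (suc x)) (suc (suc y)) = R-H x y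

  module _ (M H H′ : Graph m) (H⊏H′ : adj₂ H ⊏[ adj₂ M ] adj₂ H′) where

    extend-≤ : ∀ x y → A (extend H) x y ≤ A (extend H′) x y
    extend-≤ = extend-rel (λ _ _ → _≤_) (λ _ _ _ → ≤-refl) (λ x y → H⊏H′ .monotone (x , y))

    unchanged-or : ∀ x y → A H x y ≡ A H′ x y ⊎ adj M x y ≡ true
    unchanged-or x y with adj M x y in eq
    ... | true  = inj₂ refl
    ... | false = inj₁ (cong ⟦_⟧ (H⊏H′ .unchanged (x , y) eq))

    raised-< : let (x , y) = H⊏H′ .raised .proj₁ in A (extend H) (suc (suc x)) (suc (suc y)) < A (extend H′) (suc (suc x)) (suc (suc y))
    raised-< = let _ , _ , H≡0 , H′≡1 = H⊏H′ .raised in subst₂ (λ b c → ⟦ b ⟧ < ⟦ c ⟧) (sym H≡0) (sym H′≡1) (s≤s z≤n)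

    module _ (avoids-q : ∀ x y → adj M x y ≡ true → lookup q x ≡ false) where

      -- Walks of length 3 and 4 from vertex 1 see an entry at `x`, `y` only through its product
      -- with `V x`. At a masked edge this factor vanishes.
      V-unaffected : ∀ x y → V x * A (extend H) x y ≡ V x * A (extend H′) x y
      V-unaffected = extend-rel (λ x y a b → V x * a ≡ V x * b) (λ _ _ _ → refl) λ x y → go x y
          (unchanged-or x y)
        where
        go : ∀ x y → A H x y ≡ A H′ x y ⊎ adj M x y ≡ true →
            ⟦ lookup q x ⟧ * A H x y ≡ ⟦ lookup q x ⟧ * A H′ x y
        go x y (inj₁ eq) = cong (⟦ lookup q x ⟧ *_) eq
        go x y (inj₂ masked) rewrite avoids-q x y masked = refl

      T₁-unaffected : T₁ H ≡ T₁ H′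
      T₁-unaffected = triangles-cong {U = V} (A (extend H)) (A (extend H′)) (λ _ → refl) λ x y → cong
          (_* V y) (V-unaffected x y)

      S₁-unaffected : S₁ H ≡ S₁ H′
      S₁-unaffected = squares-cong {U = V} (A (extend H)) (A (extend H′)) (λ _ → refl) V-unaffected

    module _ (avoids-p : ∀ x y → adj M x y ≡ true → lookup p x ≡ false ⊎ lookup p y ≡ false) where

      -- A triangle at 0 needs both ends of its opposite edge among the neighbours of 0.
      T₀-unaffected : T₀ H ≡ T₀ H′
      T₀-unaffected = triangles-cong {U = U} (A (extend H)) (A (extend H′)) (λ _ → refl)
        (extend-rel {H} {H′} (λ x y a b → U x * a * U y ≡ U x * b * U y)
            (λ _ _ _ → refl) λ x y → go x y (unchanged-or x y))
        where
        go : ∀ x y → A H x y ≡ A H′ x y ⊎ adj M x y ≡ true →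
             ⟦ lookup p x ⟧ * A H x y * ⟦ lookup p y ⟧ ≡ ⟦ lookup p x ⟧ * A H′ x y * ⟦ lookup p y ⟧
        go x y (inj₁ eq) = cong (λ a → ⟦ lookup p x ⟧ * a * ⟦ lookup p y ⟧) eq
        go x y (inj₂ masked) with avoids-p x y masked
        ... | inj₁ px rewrite px = refl
        ... | inj₂ py rewrite py = trans (*-zeroʳ (⟦ lookup p x ⟧ * A H x y))
            (sym (*-zeroʳ (⟦ lookup p x ⟧ * A H′ x y)))

    T₀-increases : (∀ x y → adj M x y ≡ true → lookup p x ≡ true × lookup p y ≡ true) → T₀ H < T₀ H′
    T₀-increases inside = let (x , y) , M≡1 , _ = H⊏H′ .raised ; px , py = inside x y M≡1 in
      triangles-mono-< U extend-≤ (suc (suc x)) (suc (suc y)) (cong ⟦_⟧ px) (cong ⟦_⟧ py) raised-<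

    -- One end among the neighbours of 0 suffices here, unlike for triangles: from 0 to that end,
    -- along the edge, and back the same way is a closed 4-walk. This difference separates the roles
    -- of the two masks.
    S₀-increases : (∀ x y → adj M x y ≡ true → lookup p x ≡ true ⊎ lookup p y ≡ true) → S₀ H < S₀ H′
    S₀-increases inside with H⊏H′ .raised | raised-<
    ... | (x , y) , M≡1 , _ | H<H′ with inside x y M≡1
    ...   | inj₁ px = squares-mono-< U extend-≤ (suc (suc x)) (suc (suc y)) (cong ⟦_⟧ px) H<H′
    ...   | inj₂ py = squares-mono-< U extend-≤ (suc (suc y)) (suc (suc x)) (cong ⟦_⟧ py)
                        (subst₂ _<_ (A-sym H x y) (A-sym H′ x y) H<H′)

  a d : Fin m → Bool
  a x = onlyFirst (lookup p x) (lookup q x)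
  d x = neither (lookup p x) (lookup q x)

  |a| |d| : ℕ
  |a| = pairCount onlyFirst p q
  |d| = pairCount neither p q

  -- The complete graph on A and the complete bipartite graph between A and D.
  AA AD : Fin m → Fin m → Bool
  AA x y = (a x ∧ a y) ∧ not (does (y ≟ᶠ x))
  AD x y = (a x ∧ d y) ∨ (d x ∧ a y)

  AA-irrefl : ∀ x → AA x x ≡ false
  AA-irrefl x with x ≟ᶠ x
  ... | yes _  = ∧-zeroʳ (a x ∧ a x)
  ... | no x≢x = contradiction refl x≢x

  AA-sym : ∀ x y → AA x y ≡ AA y x
  AA-sym x y = cong₂ (λ b c → b ∧ not c) (∧-comm (a x) (a y)) (does-sym (y ≟ᶠ x) (x ≟ᶠ y))
    where
    does-sym : (P? : Dec (y ≡ x)) (Q? : Dec (x ≡ y)) → does P? ≡ does Q?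
    does-sym (yes _)   (yes _)   = refl
    does-sym (yes y≡x) (no x≢y)  = contradiction (sym y≡x) x≢y
    does-sym (no y≢x)  (yes x≡y) = contradiction (sym x≡y) y≢x
    does-sym (no _)    (no _)    = refl

  disjoint : ∀ b c → onlyFirst b c ∧ neither b c ≡ false
  disjoint false c = refl
  disjoint true  c = ∧-zeroʳ (not c)

  AD-irrefl : ∀ x → AD x x ≡ false
  AD-irrefl x = cong₂ _∨_ (disjoint (lookup p x) (lookup q x))
      (trans (∧-comm (d x) (a x)) (disjoint (lookup p x) (lookup q x)))

  AD-sym : ∀ x y → AD x y ≡ AD y x
  AD-sym x y = trans (∨-comm (a x ∧ d y) (d x ∧ a y)) (cong₂ _∨_ (∧-comm (d x) (a y)) (∧-comm (a x) (d y)))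

  maskAA maskAD : Graph m
  maskAA = adj-surjective AA AA-irrefl AA-sym .proj₁
  maskAD = adj-surjective AD AD-irrefl AD-sym .proj₁

  adj-maskAA : ∀ x y → adj maskAA x y ≡ AA x y
  adj-maskAA = adj-surjective AA AA-irrefl AA-sym .proj₂

  adj-maskAD : ∀ x y → adj maskAD x y ≡ AD x y
  adj-maskAD = adj-surjective AD AD-irrefl AD-sym .proj₂

  a-true : ∀ x → a x ≡ true → lookup p x ≡ true × lookup q x ≡ false
  a-true x eq = let px , qx = ∧-true (lookup p x) eq in px , not-true (lookup q x) qx

  d-true : ∀ x → d x ≡ true → lookup p x ≡ false × lookup q x ≡ false
  d-true x eq = let px , qx = ∧-true (not (lookup p x)) eq in not-true (lookup p x) px , not-true (lookup q x) qx

  in-AA : ∀ x y → adj maskAA x y ≡ true → a x ≡ true × a y ≡ true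
  in-AA x y eq = ∧-true (a x) (∧-true (a x ∧ a y) (trans (sym (adj-maskAA x y)) eq) .proj₁)

  in-AD : ∀ x y → adj maskAD x y ≡ true → (a x ≡ true × d y ≡ true) ⊎ (d x ≡ true × a y ≡ true)
  in-AD x y eq with ∨-true (a x ∧ d y) (trans (sym (adj-maskAD x y)) eq)
  ... | inj₁ eq′ = inj₁ (∧-true (a x) eq′)
  ... | inj₂ eq′ = inj₂ (∧-true (d x) eq′)

  AA-avoids-q : ∀ x y → adj maskAA x y ≡ true → lookup q x ≡ false
  AA-avoids-q x y eq = a-true x (in-AA x y eq .proj₁) .proj₂

  AA-inside-p : ∀ x y → adj maskAA x y ≡ true → lookup p x ≡ true × lookup p y ≡ true
  AA-inside-p x y eq = let ax , ay = in-AA x y eq in a-true x ax .proj₁ , a-true y ay .proj₁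

  AD-avoids-q : ∀ x y → adj maskAD x y ≡ true → lookup q x ≡ false
  AD-avoids-q x y eq with in-AD x y eq
  ... | inj₁ (ax , _) = a-true x ax .proj₂
  ... | inj₂ (dx , _) = d-true x dx .proj₂

  AD-avoids-p : ∀ x y → adj maskAD x y ≡ true → lookup p x ≡ false ⊎ lookup p y ≡ false
  AD-avoids-p x y eq with in-AD x y eq
  ... | inj₁ (_ , dy) = inj₂ (d-true y dy .proj₁)
  ... | inj₂ (dx , _) = inj₁ (d-true x dx .proj₁)

  AD-touches-p : ∀ x y → adj maskAD x y ≡ true → lookup p x ≡ true ⊎ lookup p y ≡ true
  AD-touches-p x y eq with in-AD x y eq
  ... | inj₁ (ax , _) = inj₁ (a-true x ax .proj₁)
  ... | inj₂ (_ , ay) = inj₂ (a-true y ay .proj₁)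

  sum-product : ∀ {n} (f g : Fin n → ℕ) → sum (λ x → sum λ y → f x * g y) ≡ sum f * sum g
  sum-product f g = trans (sum-cong-≗ λ x → sym (*-distribˡ-sum (f x) g)) (sym (*-distribʳ-sum (sum g) f))

  ones-AD : ones (flatten maskAD) ≡ |a| * |d|
  ones-AD = *-cancelˡ-≡ _ _ 2 (begin
    2 * ones (flatten maskAD)                          ≡⟨ handshake maskAD ⟨
    sum (λ x → sum λ y → A maskAD x y)
      ≡⟨ sum-cong-≗ (λ x → trans
           (sum-cong-≗ λ y → trans (cong ⟦_⟧ (adj-maskAD x y))
               (split (lookup p x) (lookup q x) (lookup p y) (lookup q y)))
                     (∑-distrib-+ (λ y → ⟦ a x ⟧ * ⟦ d y ⟧)
                     (λ y → ⟦ d x ⟧ * ⟦ a y ⟧))) ⟩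
    sum (λ x → sum (λ y → ⟦ a x ⟧ * ⟦ d y ⟧) + sum λ y → ⟦ d x ⟧ * ⟦ a y ⟧)
      ≡⟨ ∑-distrib-+ (λ x → sum λ y → ⟦ a x ⟧ * ⟦ d y ⟧) (λ x → sum λ y → ⟦ d x ⟧ * ⟦ a y ⟧) ⟩
    sum (λ x → sum λ y → ⟦ a x ⟧ * ⟦ d y ⟧) + sum (λ x → sum λ y → ⟦ d x ⟧ * ⟦ a y ⟧)
      ≡⟨ cong₂ _+_ (sum-product (⟦_⟧ ∘ a) (⟦_⟧ ∘ d))
           (trans (sum-product (⟦_⟧ ∘ d) (⟦_⟧ ∘ a)) (*-comm |d| |a|)) ⟩
    |a| * |d| + |a| * |d|                              ≡⟨ cong (|a| * |d| +_) (+-identityʳ _) ⟨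
    2 * (|a| * |d|)                                    ∎)
    where
    open ≡-Reasoning
    split : ∀ b c b′ c′ → ⟦ (onlyFirst b c ∧ neither b′ c′) ∨ (neither b c ∧ onlyFirst b′ c′) ⟧ ≡
          ⟦ onlyFirst b c ⟧ * ⟦ neither b′ c′ ⟧ + ⟦ neither b c ⟧ * ⟦ onlyFirst b′ c′ ⟧
    split false false false false = refl
    split false false false true  = refl
    split false false true  false = refl
    split false false true  true  = refl
    split false true  _     _     = refl
    split true  false false false = refl
    split true  false false true  = refl
    split true  false true  _     = refl
    split true  true  _     _     = refl

  -- The clique has `|a|(|a| - 1)/2` edges. Stated without subtraction: the summand `|a|` supplies
  -- the diagonal that `AA` omits.
  ones-AA : 2 * ones (flatten maskAA) + |a| ≡ |a| * |a|
  ones-AA = begin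
    2 * ones (flatten maskAA) + |a|                    ≡⟨ cong (_+ |a|) (handshake maskAA) ⟨
    sum (λ x → sum λ y → A maskAA x y) + |a|
      ≡⟨ cong (sum (λ x → sum λ y → A maskAA x y) +_) (sum-cong-≗ λ x → sym (sum-≟ (⟦_⟧ ∘ a) x)) ⟩
    sum (λ x → sum λ y → A maskAA x y) + sum (λ x → sum λ y → ⟦ a y ⟧ * [ y ≟ᶠ x ])
      ≡⟨ ∑-distrib-+ (λ x → sum λ y → A maskAA x y) (λ x → sum λ y → ⟦ a y ⟧ * [ y ≟ᶠ x ]) ⟨
    sum (λ x → sum (λ y → A maskAA x y) + sum (λ y → ⟦ a y ⟧ * [ y ≟ᶠ x ]))
      ≡⟨ sum-cong-≗ (λ x → trans (sym (∑-distrib-+ (λ y → A maskAA x y) (λ y → ⟦ a y ⟧ * [ y ≟ᶠ x ])))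
           (sum-cong-≗ λ y → trans (cong (λ b → ⟦ b ⟧ + ⟦ a y ⟧ * [ y ≟ᶠ x ]) (adj-maskAA x y))
               (split x y (y ≟ᶠ x)))) ⟩
    sum (λ x → sum λ y → ⟦ a x ⟧ * ⟦ a y ⟧)            ≡⟨ sum-product (⟦_⟧ ∘ a) (⟦_⟧ ∘ a) ⟩
    |a| * |a|                                          ∎
    where
    open ≡-Reasoning
    diag : ∀ b → ⟦ (b ∧ b) ∧ false ⟧ + ⟦ b ⟧ * 1 ≡ ⟦ b ⟧ * ⟦ b ⟧
    diag false = refl
    diag true  = refl
    offDiag : ∀ b c → ⟦ (b ∧ c) ∧ true ⟧ + ⟦ c ⟧ * 0 ≡ ⟦ b ⟧ * ⟦ c ⟧
    offDiag false false = refl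
    offDiag false true  = refl
    offDiag true  false = refl
    offDiag true  true  = refl
    split : ∀ x y (P? : Dec (y ≡ x)) → ⟦ (a x ∧ a y) ∧ not
        (does P?) ⟧ + ⟦ a y ⟧ * [ P? ] ≡ ⟦ a x ⟧ * ⟦ a y ⟧
    split x y (yes refl) = diag (a x)
    split x y (no _)     = offDiag (a x) (a y)

  coincidences : ℕ
  coincidences = ∑ᴳ m λ H → [ T₀ H ≟ T₁ H ] * [ S₀ H ≟ S₁ H ]

  coincidences≤ : coincidences ≤ 2 ^ edges m
  coincidences≤ = begin
    coincidences
      ≤⟨ ∑ᵛ-mono (edges m)
           (λ h → *-mono-≤ (⟦⟧≤1 (does (T₀ (unflatten m h) ≟ T₁ (unflatten m h))))
               (⟦⟧≤1 (does (S₀ (unflatten m h) ≟ S₁ (unflatten m h))))) ⟩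
    ∑ᵛ (edges m) (λ _ → 1)        ≡⟨ ∑ᵛ-const (edges m) 1 ⟩
    2 ^ edges m * 1               ≡⟨ *-identityʳ _ ⟩
    2 ^ edges m                   ∎
    where open ≤-Reasoning

  -- The equation for triangles is the weight while the edges between A and D are varied, as they do
  -- not affect it; the total weight is then bounded by varying the edges inside A. The order cannot
  -- be reversed, because edges inside A raise `S₀` as well.
  coincidences-bound : ∀ s → s ≤ |a| → s ≤ |d| → s * (s * coincidences) ≤ 4 * 2 ^ edges m
  coincidences-bound s s≤a s≤d = begin
    s * (s * coincidences)                    ≤⟨ *-monoʳ-≤ s fourth ⟩
    s * (2 * ∑ᵛ (edges m) h)                  ≡⟨ regroup₁ s _ ⟩
    2 * (s * ∑ᵛ (edges m) h)
      ≡⟨ cong (λ x → 2 * (s * x)) (∑ᵛ-cong (edges m) λ g → sym (+-identityʳ (h g))) ⟩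
    2 * (s * hits (λ _ → 1) (T₁ ∘ unflatten m) (T₀ ∘ unflatten m)) ≤⟨ *-monoʳ-≤ 2 third ⟩
    2 * (2 * ∑ᵛ (edges m) (λ _ → 1))
      ≡⟨ cong (λ x → 2 * (2 * x)) (trans (∑ᵛ-const (edges m) 1) (*-identityʳ (2 ^ edges m))) ⟩
    2 * (2 * 2 ^ edges m)                     ≡⟨ *-assoc 2 2 (2 ^ edges m) ⟨
    4 * 2 ^ edges m                           ∎
    where
    open ≤-Reasoning
    regroup₁ : ∀ s x → s * (2 * x) ≡ 2 * (s * x)
    regroup₁ = solve-∀
    h : Vec Bool (edges m) → ℕ
    h g = [ T₀ (unflatten m g) ≟ T₁ (unflatten m g) ]
    fourth : s * coincidences ≤ 2 * ∑ᵛ (edges m) h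
    fourth = sperner-scaled (flatten maskAD) h (S₁ ∘ unflatten m) (S₀ ∘ unflatten m) s
      (≤-trans (*-mono-≤ s≤a s≤d) (≤-trans (≤-reflexive (sym ones-AD)) (≤-trans (n≤1+n _) (m≤n*m _ 4))))
      (λ g g′ ρ → cong₂ (λ x y → [ x ≟ y ])
          (T₀-unaffected maskAD (unflatten m g) (unflatten m g′) (raise-adj maskAD ρ) AD-avoids-p)
              (T₁-unaffected maskAD (unflatten m g) (unflatten m g′) (raise-adj maskAD ρ) AD-avoids-q))
      (λ g g′ ρ → S₁-unaffected maskAD (unflatten m g) (unflatten m g′) (raise-adj maskAD ρ) AD-avoids-q)
      (λ g g′ ρ → S₀-increases maskAD (unflatten m g) (unflatten m g′) (raise-adj maskAD ρ) AD-touches-p)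
    -- The clique has fewer than half of `|a| * |a|` edges; the factor 4 makes up for the half and
    -- for the diagonal.
    enough : |a| * |a| ≤ 4 * suc (ones (flatten maskAA))
    enough = +-cancelʳ-≤ (2 * |a|) _ _ (begin
      |a| * |a| + 2 * |a|                                 ≤⟨ +-monoʳ-≤ (|a| * |a|) (twice |a|) ⟩
      |a| * |a| + (|a| * |a| + 4)                         ≡⟨ cong (λ x → x + (x + 4)) ones-AA ⟨
      2 * N + |a| + (2 * N + |a| + 4)                     ≡⟨ regroup₂ N |a| ⟩
      4 * suc N + 2 * |a|                                 ∎)
      where
      N = ones (flatten maskAA)
      twice : ∀ k → 2 * k ≤ k * k + 4
      twice zero          = z≤n
      twice (suc zero)    = s≤s (s≤s z≤n)
      twice (suc (suc k)) = ≤-trans (*-monoˡ-≤ (2 + k) {2} {2 + k} (s≤s (s≤s z≤n))) (m≤m+n _ 4)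
      regroup₂ : ∀ n a → 2 * n + a + (2 * n + a + 4) ≡ 4 * suc n + 2 * a
      regroup₂ = solve-∀
    third : s * hits (λ _ → 1) (T₁ ∘ unflatten m) (T₀ ∘ unflatten m) ≤ 2 * ∑ᵛ (edges m) (λ _ → 1)
    third = sperner-scaled (flatten maskAA) (λ _ → 1) (T₁ ∘ unflatten m) (T₀ ∘ unflatten m) s
      (≤-trans (*-mono-≤ s≤a s≤a) enough)
      (λ g g′ ρ → refl)
      (λ g g′ ρ → T₁-unaffected maskAA (unflatten m g) (unflatten m g′) (raise-adj maskAA ρ) AA-avoids-q)
      (λ g g′ ρ → T₀-increases maskAA (unflatten m g) (unflatten m g′) (raise-adj maskAA ρ) AA-inside-p)

-- Probability that 0 and 1 agree

∑² : ∀ m → (Vec Bool m → Vec Bool m → ℕ) → ℕ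
∑² m f = ∑ᵛ m λ p → ∑ᵛ m λ q → f p q

module _ (m : ℕ) where

  ∑²-mono : ∀ {f g : Vec Bool m → Vec Bool m → ℕ} → (∀ p q → f p q ≤ g p q) → ∑² m f ≤ ∑² m g
  ∑²-mono f≤g = ∑ᵛ-mono m λ p → ∑ᵛ-mono m (f≤g p)

  ∑²-+ : ∀ (f g : Vec Bool m → Vec Bool m → ℕ) → ∑² m (λ p q → f p q + g p q) ≡ ∑² m f + ∑² m g
  ∑²-+ f g = trans (∑ᵛ-cong m λ p → ∑ᵛ-+ m (f p) (g p)) (∑ᵛ-+ m _ _)

  ∑²-*ˡ : ∀ c (f : Vec Bool m → Vec Bool m → ℕ) → ∑² m (λ p q → c * f p q) ≡ c * ∑² m f
  ∑²-*ˡ c f = trans (∑ᵛ-cong m λ p → ∑ᵛ-*ˡ m c (f p)) (∑ᵛ-*ˡ m c _)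

-- Exponential tails for the sizes of A and D

module Tail (c : Bool → Bool → Bool) where

  weight : Bool → Bool → ℕ
  weight b b′ = if c b b′ then 1 else 2

  -- This is `2 ^ (n - pairCount c p q)`, an exponential moment with its denominators cleared;
  -- `few-weight` is Markov's inequality for it.
  Weight : Vec Bool n → Vec Bool n → ℕ
  Weight []      []       = 1
  Weight (b ∷ p) (b′ ∷ q) = weight b b′ * Weight p q

  Weight-pairCount : ∀ (p q : Vec Bool n) → Weight p q * 2 ^ pairCount c p q ≡ 2 ^ n
  Weight-pairCount []      []       = refl
  Weight-pairCount (b ∷ p) (b′ ∷ q) with c b b′
  ... | true  = trans (regroup (Weight p q) (2 ^ pairCount c p q)) (cong (2 *_) (Weight-pairCount p q))
    where
    regroup : ∀ w x → 1 * w * (2 * x) ≡ 2 * (w * x)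
    regroup = solve-∀
  ... | false = trans (*-assoc 2 (Weight p q) _) (cong (2 *_) (Weight-pairCount p q))

  few : ℕ → Vec Bool n → Vec Bool n → ℕ
  few s p q = [ pairCount c p q <? s ]

  few-weight : ∀ s (p q : Vec Bool n) → 2 ^ n * few s p q ≤ 2 ^ s * Weight p q
  few-weight {n} s p q with pairCount c p q <? s
  ... | no ≮s  = ≤-trans
      (≤-reflexive (trans (cong (2 ^ n *_) ([]-no (pairCount c p q <? s) ≮s)) (*-zeroʳ (2 ^ n)))) z≤n
  ... | yes <s = begin
    2 ^ n * few s p q
      ≡⟨ trans (cong (2 ^ n *_) ([]-yes (pairCount c p q <? s) <s)) (*-identityʳ (2 ^ n)) ⟩
    2 ^ n                              ≡⟨ Weight-pairCount p q ⟨
    Weight p q * 2 ^ pairCount c p q   ≤⟨ *-monoʳ-≤ (Weight p q) (^-monoʳ-≤ 2 (<⇒≤ <s)) ⟩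
    Weight p q * 2 ^ s                 ≡⟨ *-comm (Weight p q) (2 ^ s) ⟩
    2 ^ s * Weight p q                 ∎
    where open ≤-Reasoning

  module _ (total : (weight false false + weight false true) +
      (weight true false + weight true true) ≡ 7) where

    -- Coordinates are independent and exactly one of the four pairs of bits satisfies `c`, so each
    -- coordinate contributes 1 + 2 + 2 + 2 = 7. The gap to 8 is the source of the exponential
    -- decay.
    ∑²-Weight : ∀ m → ∑² m Weight ≡ 7 ^ m
    ∑²-Weight zero    = refl
    ∑²-Weight (suc m) = begin
      ∑² (suc m) Weight                                ≡⟨ cong₂ _+_ (half false) (half true) ⟩
      (weight false false + weight false true) * ∑² m Weight +
          (weight true false + weight true true) * ∑² m Weight
        ≡⟨ *-distribʳ-+ (∑² m Weight) (weight false false + weight false true) _ ⟨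
      ((weight false false + weight false true) + (weight true false + weight true true)) * ∑² m Weight
        ≡⟨ cong₂ _*_ total (∑²-Weight m) ⟩
      7 ^ suc m                                        ∎
      where
      open ≡-Reasoning
      half : ∀ b → ∑ᵛ m (λ p → ∑ᵛ (suc m) λ q → Weight (b ∷ p) q) ≡
          (weight b false + weight b true) * ∑² m Weight
      half b = trans (∑ᵛ-+ m (λ p → ∑ᵛ m λ q → weight b false * Weight p q)
          (λ p → ∑ᵛ m λ q → weight b true * Weight p q))
        (trans (cong₂ _+_ (∑²-*ˡ m (weight b false) Weight) (∑²-*ˡ m (weight b true) Weight))
          (sym (*-distribʳ-+ (∑² m Weight) (weight b false) _)))

    tail-bound : ∀ m s → 2 ^ m * ∑² m (few s) ≤ 2 ^ s * 7 ^ m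
    tail-bound m s = begin
      2 ^ m * ∑² m (few s)                    ≡⟨ ∑²-*ˡ m (2 ^ m) (few s) ⟨
      ∑² m (λ p q → 2 ^ m * few s p q)        ≤⟨ ∑²-mono m (few-weight s) ⟩
      ∑² m (λ p q → 2 ^ s * Weight p q)       ≡⟨ ∑²-*ˡ m (2 ^ s) Weight ⟩
      2 ^ s * ∑² m Weight                     ≡⟨ cong (2 ^ s *_) (∑²-Weight m) ⟩
      2 ^ s * 7 ^ m                           ∎
      where open ≤-Reasoning

    -- The 32 makes 16 * 7 ^ 32 ≤ 8 ^ 32.
    exponential-tail : ∀ m s → 32 * s ≤ m → 8 ^ s * ∑² m (few s) ≤ 4 ^ m
    exponential-tail m s 32s≤m = *-cancelˡ-≤ (2 ^ m) {{m^n≢0 2 m}} (begin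
      2 ^ m * (8 ^ s * ∑² m (few s))          ≡⟨ regroup (2 ^ m) (8 ^ s) _ ⟩
      8 ^ s * (2 ^ m * ∑² m (few s))          ≤⟨ *-monoʳ-≤ (8 ^ s) (tail-bound m s) ⟩
      8 ^ s * (2 ^ s * 7 ^ m)                 ≡⟨ *-assoc (8 ^ s) (2 ^ s) (7 ^ m) ⟨
      8 ^ s * 2 ^ s * 7 ^ m                   ≡⟨ cong₂ _*_ (sym (^-distribʳ-* 8 2 s)) (cong (7 ^_) m≡) ⟩
      16 ^ s * 7 ^ (32 * s + t)
        ≡⟨ cong (16 ^ s *_) (trans (^-distribˡ-+-* 7 (32 * s) t)
             (cong (_* 7 ^ t) (sym (^-*-assoc 7 32 s)))) ⟩
      16 ^ s * ((7 ^ 32) ^ s * 7 ^ t)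
        ≡⟨ trans (sym (*-assoc (16 ^ s) ((7 ^ 32) ^ s) (7 ^ t)))
             (cong (_* 7 ^ t) (sym (^-distribʳ-* 16 (7 ^ 32) s))) ⟩
      (16 * 7 ^ 32) ^ s * 7 ^ t
        ≤⟨ *-mono-≤ (^-monoˡ-≤ s (≤ᵇ⇒≤ (16 * 7 ^ 32) (8 ^ 32) tt)) (^-monoˡ-≤ t (n≤1+n 7)) ⟩
      (8 ^ 32) ^ s * 8 ^ t
        ≡⟨ trans (cong (_* 8 ^ t) (^-*-assoc 8 32 s)) (sym (^-distribˡ-+-* 8 (32 * s) t)) ⟩
      8 ^ (32 * s + t)                        ≡⟨ cong (8 ^_) m≡ ⟨
      8 ^ m                                   ≡⟨ ^-distribʳ-* 2 4 m ⟩
      2 ^ m * 4 ^ m                           ∎)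
      where
      open ≤-Reasoning
      t = m ∸ 32 * s
      m≡ : m ≡ 32 * s + t
      m≡ = sym (m+[n∸m]≡n 32s≤m)
      regroup : ∀ a b c → a * (b * c) ≡ b * (a * c)
      regroup = solve-∀

-- Equal degrees

ones-increasing : ∀ {M p p′ : Vec Bool n} → Raise M p p′ → ones p < ones p′
ones-increasing here                  = ≤-refl
ones-increasing (there {b = b} p⊏p′)  = +-monoʳ-< ⟦ b ⟧ (ones-increasing p⊏p′)

ones-replicate : ∀ m → ones (replicate m true) ≡ m
ones-replicate zero    = refl
ones-replicate (suc m) = cong suc (ones-replicate m)

-- The edge between the two vertices contributes the same to both degrees and is left out.
equalDegrees : Vec Bool n → Vec Bool n → ℕ
equalDegrees p q = [ ones q ≟ ones p ]

-- For a fixed `p`, the vectors `q` with as many ones as `p` form an antichain: Sperner's theorem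
-- with every bit masked and a constant target.
∑²-equalDegrees : ∀ m → ∑² m equalDegrees ≤ 2 ^ m * L m 1
∑²-equalDegrees m = begin
  ∑² m equalDegrees            ≤⟨ ∑ᵛ-mono m inner ⟩
  ∑ᵛ m (λ _ → L m 1)           ≡⟨ ∑ᵛ-const m (L m 1) ⟩
  2 ^ m * L m 1                ∎
  where
  open ≤-Reasoning
  inner : ∀ p → ∑ᵛ m (equalDegrees p) ≤ L m 1
  inner p = *-cancelˡ-≤ (2 ^ m) {{m^n≢0 2 m}} (begin
    2 ^ m * ∑ᵛ m (equalDegrees p)
      ≡⟨ cong (2 ^ m *_) (∑ᵛ-cong m λ q → sym (+-identityʳ (equalDegrees p q))) ⟩
    2 ^ m * H                        ≤⟨ subst (λ N → 2 ^ N * H ≤ L N 1 * ∑ᵛ m (λ _ → 1)) (ones-replicate m)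
          (sperner (replicate m true) (λ _ → 1) (λ _ → ones p) ones
          (λ _ _ _ → refl) (λ _ _ _ → refl) (λ _ _ → ones-increasing)) ⟩
    L m 1 * ∑ᵛ m (λ _ → 1)           ≡⟨ cong (L m 1 *_) (trans (∑ᵛ-const m 1) (*-identityʳ (2 ^ m))) ⟩
    L m 1 * 2 ^ m                    ≡⟨ *-comm (L m 1) (2 ^ m) ⟩
    2 ^ m * L m 1                    ∎)
    where
    H : ℕ
    H = hits {n = m} (λ _ → 1) (λ _ → ones p) ones

equalDegrees-bound : ∀ m → ∑² m equalDegrees * ∑² m equalDegrees * suc m ≤ 4 ^ m * 4 ^ m
equalDegrees-bound m = begin
  Q * Q * suc m
    ≤⟨ *-monoˡ-≤ (suc m) (*-mono-≤ (∑²-equalDegrees m) (∑²-equalDegrees m)) ⟩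
  2 ^ m * L m 1 * (2 ^ m * L m 1) * suc m         ≡⟨ regroup (2 ^ m) (L m 1) (suc m) ⟩
  2 ^ m * 2 ^ m * (L m 1 * L m 1 * suc m)
    ≤⟨ *-mono-≤ (≤-reflexive (sym (^-distribʳ-* 2 2 m))) (L-one-bound m) ⟩
  4 ^ m * 4 ^ m                                   ∎
  where
  open ≤-Reasoning
  Q = ∑² m equalDegrees
  regroup : ∀ a l s → a * l * (a * l) * s ≡ a * a * (l * l * s)
  regroup = solve-∀

record Same (G : Graph n) (u v : Fin n) : Set where
  constructor mkSame
  field
    same₂ : r G 2 u ≡ r G 2 v
    same₃ : r G 3 u ≡ r G 3 v
    same₄ : r G 4 u ≡ r G 4 v

same? : ∀ (G : Graph n) u v → Dec (Same G u v)
same? G u v = map′ (λ (r₂≡ , r₃≡ , r₄≡) → mkSame r₂≡ r₃≡ r₄≡) (λ (mkSame r₂≡ r₃≡ r₄≡) → r₂≡ , r₃≡ , r₄≡)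
  ((r G 2 u ≟ r G 2 v) ×-dec ((r G 3 u ≟ r G 3 v) ×-dec (r G 4 u ≟ r G 4 v)))

-- Abstract, so that the type checker never unfolds the enumeration of walks.
abstract
  same : Graph n → Fin n → Fin n → ℕ
  same G u v = [ same? G u v ]

  same-yes : ∀ (G : Graph n) u v → Same G u v → same G u v ≡ 1
  same-yes G u v = []-yes (same? G u v)

  same-mono : ∀ (G : Graph n) u v {P : Set} (P? : Dec P) → (Same G u v → P) → same G u v ≤ [ P? ]
  same-mono G u v = []-mono (same? G u v)

  same-cong : ∀ (G H : Graph n) u v x y → (Same G u v → Same H x y) → (Same H x y → Same G u v) →
      same G u v ≡ same H x y
  same-cong G H u v x y = []-cong (same? G u v) (same? H x y)

module _ {m : ℕ} (e : Bool) (p q : Vec Bool m) where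
  open TwoRows e p q

  same-extend : ∀ H → same (extend H) zero (suc zero) ≤ equalDegrees p q *
      ([ T₀ H ≟ T₁ H ] * [ S₀ H ≟ S₁ H ])
  same-extend H = ≤-trans
    (same-mono G zero (suc zero) ((ones q ≟ ones p) ×-dec ((T₀ H ≟ T₁ H) ×-dec (S₀ H ≟ S₁ H)))
      λ (mkSame r₂≡ r₃≡ r₄≡) →
        sym (+-cancelˡ-≡ ⟦ e ⟧ (ones p) (ones q) (trans (sym deg₀) (trans r₂≡ deg₁)))
        , trans (sym third₀) (trans r₃≡ third₁)
        , trans (sym fourth₀) (trans r₄≡ fourth₁))
    (≤-reflexive (trans ([]-× (ones q ≟ ones p) ((T₀ H ≟ T₁ H) ×-dec (S₀ H ≟ S₁ H)))
        (cong (equalDegrees p q *_) ([]-× (T₀ H ≟ T₁ H) (S₀ H ≟ S₁ H)))))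
    where
    G = extend H
    deg₀ : r G 2 zero ≡ ⟦ e ⟧ + ones p
    deg₀ = trans (r₂ G zero) (cong (⟦ e ⟧ +_) (ones-sum p))
    deg₁ : r G 2 (suc zero) ≡ ⟦ e ⟧ + ones q
    deg₁ = trans (r₂ G (suc zero)) (cong (⟦ e ⟧ +_) (ones-sum q))
    third₀ : r G 3 zero ≡ T₀ H
    third₀ = trans (r₃ G zero) (triangles-cong {U = A G zero} (A G) (A G) (row₀ H) (λ _ _ → refl))
    third₁ : r G 3 (suc zero) ≡ T₁ H
    third₁ = trans (r₃ G (suc zero))
        (triangles-cong {U = A G (suc zero)} (A G) (A G) (row₁ H) (λ _ _ → refl))
    fourth₀ : r G 4 zero ≡ S₀ H
    fourth₀ = trans (r₄ G zero) (squares-cong {U = A G zero} (A G) (A G) (row₀ H) (λ _ _ → refl))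
    fourth₁ : r G 4 (suc zero) ≡ S₁ H
    fourth₁ = trans (r₄ G (suc zero))
        (squares-cong {U = A G (suc zero)} (A G) (A G) (row₁ H) (λ _ _ → refl))

  -- The degree condition depends on the rows alone and leaves the sum over `H`. This is how the
  -- degree factor multiplies with the other two.
  ∑-same≤ : ∑ᴳ m (λ H → same (extend H) zero (suc zero)) ≤ equalDegrees p q * coincidences
  ∑-same≤ = ≤-trans (∑ᵛ-mono (edges m) (same-extend ∘ unflatten m))
      (≤-reflexive (∑ᵛ-*ˡ (edges m) (equalDegrees p q)
          (λ h → [ T₀ (unflatten m h) ≟ T₁ (unflatten m h) ] * [ S₀ (unflatten m h) ≟ S₁
              (unflatten m h) ])))

  open Tail using (few)

  -- Rows with both sets of size at least `s` obey `coincidences-bound`. For the others every `H` is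
  -- allowed and even the degree condition is given up; the `few` terms pay for them.
  ∑-same-bound : ∀ s → s * s * ∑ᴳ m (λ H → same (extend H) zero (suc zero)) ≤
    2 ^ edges m * (4 * equalDegrees p q + s * s * (few onlyFirst s p q + few neither s p q))
  ∑-same-bound s = ≤-trans (*-monoʳ-≤ (s * s) ∑-same≤) (go (|a| <? s) (|d| <? s))
    where
    open ≤-Reasoning
    E = 2 ^ edges m
    δ = equalDegrees p q
    atypical : ∀ x → 1 ≤ x → s * s * (δ * coincidences) ≤ E * (4 * δ + s * s * x)
    atypical x 1≤x = begin
      s * s * (δ * coincidences)
        ≤⟨ *-monoʳ-≤ (s * s) (*-mono-≤ (≤-trans (⟦⟧≤1 (does (ones q ≟ ones p))) 1≤x) coincidences≤) ⟩
      s * s * (x * E)                ≡⟨ regroup s x E ⟩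
      E * (s * s * x)                ≤⟨ *-monoʳ-≤ E (m≤n+m _ (4 * δ)) ⟩
      E * (4 * δ + s * s * x)        ∎
      where
      regroup : ∀ s x e → s * s * (x * e) ≡ e * (s * s * x)
      regroup = solve-∀
    go : Dec (|a| < s) → Dec (|d| < s) → s * s * (δ * coincidences) ≤ E *
        (4 * δ + s * s * (few onlyFirst s p q + few neither s p q))
    go (yes a<s) _ = atypical _ (≤-trans (≤-reflexive (sym ([]-yes (|a| <? s) a<s))) (m≤m+n _ _))
    go (no _) (yes d<s) = atypical _
        (≤-trans (≤-reflexive (sym ([]-yes (|d| <? s) d<s))) (m≤n+m _ (few onlyFirst s p q)))
    go (no a≮s) (no d≮s) = begin
      s * s * (δ * coincidences)     ≡⟨ regroup₁ s δ coincidences ⟩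
      δ * (s * (s * coincidences))   ≤⟨ *-monoʳ-≤ δ (coincidences-bound s (≮⇒≥ a≮s) (≮⇒≥ d≮s)) ⟩
      δ * (4 * E)                    ≡⟨ regroup₂ δ E ⟩
      E * (4 * δ)                    ≤⟨ *-monoʳ-≤ E (m≤m+n (4 * δ) _) ⟩
      E * (4 * δ + s * s * (few onlyFirst s p q + few neither s p q)) ∎
      where
      regroup₁ : ∀ s d c → s * s * (d * c) ≡ d * (s * (s * c))
      regroup₁ = solve-∀
      regroup₂ : ∀ d e → d * (4 * e) ≡ e * (4 * d)
      regroup₂ = solve-∀

sameCount : ∀ m → ℕ
sameCount m = ∑ᴳ (2 + m) λ G → same G zero (suc zero)

module _ (m s : ℕ) where
  private
    module OnlyFirst = Tail onlyFirst
    module Neither = Tail neither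
    E = 2 ^ edges m
    Q = ∑² m equalDegrees
    W = ∑² m (OnlyFirst.few s) + ∑² m (Neither.few s)

  sameCount-rows : s * s * sameCount m ≤ 2 * (E * (4 * Q + s * s * W))
  sameCount-rows = begin
    s * s * sameCount m
      ≡⟨ cong (s * s *_) (trans (∑ᴳ-suc (suc m) same₀₁)
           (∑ᵛ-cong (suc m) λ row → ∑ᴳ-suc m (same₀₁ ∘ (row ∷_)))) ⟩
    s * s * (X false + X true)           ≡⟨ *-distribˡ-+ (s * s) (X false) (X true) ⟩
    s * s * X false + s * s * X true     ≤⟨ +-mono-≤ (X-bound false) (X-bound true) ⟩
    Y + Y                                ≡⟨ cong (Y +_) (+-identityʳ Y) ⟨
    2 * Y                                ∎
    where
    open ≤-Reasoning
    Y = E * (4 * Q + s * s * W)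
    fews : Vec Bool m → Vec Bool m → ℕ
    fews p q = OnlyFirst.few s p q + Neither.few s p q
    same₀₁ : Graph (2 + m) → ℕ
    same₀₁ G = same G zero (suc zero)
    given : Bool → Vec Bool m → Vec Bool m → ℕ
    given e p q = ∑ᴳ m λ H → same₀₁ ((e ∷ p) ∷ q ∷ H)
    X : Bool → ℕ
    X e = ∑² m (given e)
    X-bound : ∀ e → s * s * X e ≤ Y
    X-bound e = begin
      s * s * X e      ≡⟨ ∑²-*ˡ m (s * s) (given e) ⟨
      ∑² m (λ p q → s * s * given e p q)
        ≤⟨ ∑²-mono m (λ p q → ∑-same-bound e p q s) ⟩
      ∑² m (λ p q → E * (4 * equalDegrees p q + s * s * fews p q))
        ≡⟨ trans (∑²-*ˡ m E (λ p q → 4 * equalDegrees p q + s * s * fews p q))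
             (cong (E *_) (trans (∑²-+ m (λ p q → 4 * equalDegrees p q) (λ p q → s * s * fews p q))
                 (cong₂ _+_ (∑²-*ˡ m 4 equalDegrees)
             (trans (∑²-*ˡ m (s * s) fews)
                 (cong (s * s *_) (∑²-+ m (OnlyFirst.few s) (Neither.few s))))))) ⟩
      Y                ∎

  module _ (32s≤m : 32 * s ≤ m) where
    private
      F = 4 ^ m
      B = sameCount m
      N = 2 ^ edges (2 + m)

    -- The tails were measured against `8 ^ s` because it is the cube of `2 ^ s` and so exceeds
    -- `s * s * s`. Two of these powers cancel the factor `s * s` in `sameCount-rows`, and the third
    -- beats the required `s^{1/2}`.
    W-bound : s * s * s * W ≤ 2 * F
    W-bound = begin
      s * s * s * W                ≤⟨ *-monoˡ-≤ W (*-mono-≤ (*-mono-≤ (n≤2^n s) (n≤2^n s)) (n≤2^n s)) ⟩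
      2 ^ s * 2 ^ s * 2 ^ s * W
        ≡⟨ cong (_* W) (trans (cong (_* 2 ^ s) (sym (^-distribʳ-* 2 2 s))) (sym (^-distribʳ-* 4 2 s))) ⟩
      8 ^ s * W                    ≡⟨ *-distribˡ-+ (8 ^ s) (∑² m (OnlyFirst.few s)) _ ⟩
      8 ^ s * ∑² m (OnlyFirst.few s) + 8 ^ s * ∑² m (Neither.few s)
            ≤⟨ +-mono-≤ (OnlyFirst.exponential-tail refl m s 32s≤m)
            (Neither.exponential-tail refl m s 32s≤m) ⟩
      F + F                        ≡⟨ cong (F +_) (+-identityʳ F) ⟨
      2 * F                        ∎
      where
      open ≤-Reasoning
      n≤2^n : ∀ n → n ≤ 2 ^ n
      n≤2^n n = <⇒≤ (n<2^n n)
        where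
        n<2^n : ∀ n → n < 2 ^ n
        n<2^n zero    = ≤-refl
        n<2^n (suc n) = +-mono-≤ (m^n>0 2 n) (≤-trans (n<2^n n) (≤-reflexive (sym (+-identityʳ (2 ^ n)))))

    -- `Q` is bounded only through its square, so the two summands of `sameCount-rows` must be
    -- separated when that bound is squared.
    sum-of-squares : ∀ a b → (a + b) * (a + b) ≤ 2 * (a * a + b * b)
    sum-of-squares a b = ≤-trans (≤-reflexive (expand a b))
        (≤-trans (+-monoʳ-≤ (a * a + b * b) (ordered a b)) (≤-reflexive (double (a * a + b * b))))
      where
      expand : ∀ a b → (a + b) * (a + b) ≡ a * a + b * b + 2 * (a * b)
      expand = solve-∀
      double : ∀ x → x + x ≡ 2 * x
      double = solve-∀
      shifted : ∀ a d → 2 * (a * (a + d)) ≤ a * a + (a + d) * (a + d)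
      shifted a d = ≤-trans (m≤m+n _ (d * d)) (≤-reflexive (identity a d))
        where
        identity : ∀ a d → 2 * (a * (a + d)) + d * d ≡ a * a + (a + d) * (a + d)
        identity = solve-∀
      ordered : ∀ a b → 2 * (a * b) ≤ a * a + b * b
      ordered a b with ≤-total a b
      ... | inj₁ a≤b = subst (λ b → 2 * (a * b) ≤ a * a + b * b) (m+[n∸m]≡n a≤b) (shifted a (b ∸ a))
      ... | inj₂ b≤a = subst (λ a → 2 * (a * b) ≤ a * a + b * b) (m+[n∸m]≡n b≤a)
        (subst₂ _≤_ (cong (2 *_) (*-comm b _)) (+-comm (b * b) _) (shifted b (a ∸ b)))

    total-graphs : N ≡ 2 * F * E
    total-graphs = begin
      2 ^ (suc m + (m + edges m))            ≡⟨ ^-distribˡ-+-* 2 (suc m) _ ⟩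
      2 * 2 ^ m * 2 ^ (m + edges m)          ≡⟨ cong (2 * 2 ^ m *_) (^-distribˡ-+-* 2 m (edges m)) ⟩
      2 * 2 ^ m * (2 ^ m * E)                ≡⟨ regroup (2 ^ m) E ⟩
      2 * (2 ^ m * 2 ^ m) * E                ≡⟨ cong (λ x → 2 * x * E) (^-distribʳ-* 2 2 m) ⟨
      2 * F * E                              ∎
      where
      open ≡-Reasoning
      regroup : ∀ a e → 2 * a * (a * e) ≡ 2 * (a * a) * e
      regroup = solve-∀

    sameCount-bound : B * B * s ^ 5 ≤ 40 * (N * N)
    sameCount-bound = begin
      B * B * s ^ 5                                                   ≡⟨ regroup₁ B s ⟩
      s * s * B * (s * s * B) * s
        ≤⟨ *-monoˡ-≤ s (*-mono-≤ sameCount-rows sameCount-rows) ⟩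
      2 * (E * (4 * Q + s * s * W)) * (2 * (E * (4 * Q + s * s * W))) * s
            ≡⟨ regroup₂ E (4 * Q + s * s * W) s ⟩
      4 * (E * E) * ((4 * Q + s * s * W) * (4 * Q + s * s * W) * s)
        ≤⟨ *-monoʳ-≤ (4 * (E * E)) (*-monoˡ-≤ s (sum-of-squares (4 * Q) (s * s * W))) ⟩
      4 * (E * E) * (2 * (4 * Q * (4 * Q) + s * s * W * (s * s * W)) * s)
            ≡⟨ regroup₃ E Q s W ⟩
      4 * (E * E) * (2 * (16 * (Q * Q * s) + s * (s * s * W) * (s * s * W)))
        ≤⟨ *-monoʳ-≤ (4 * (E * E)) (*-monoʳ-≤ 2 (+-mono-≤ (*-monoʳ-≤ 16 Q-part) W-part)) ⟩
      4 * (E * E) * (2 * (16 * (F * F) + 2 * F * (2 * F)))            ≡⟨ regroup₄ E F ⟩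
      40 * (2 * F * E * (2 * F * E))
        ≡⟨ cong (λ x → 40 * (x * x)) total-graphs ⟨
      40 * (N * N)                                                    ∎
      where
      open ≤-Reasoning
      s≤m : s ≤ m
      s≤m = ≤-trans (m≤n*m s 32) 32s≤m
      Q-part : Q * Q * s ≤ F * F
      Q-part = ≤-trans (*-monoʳ-≤ (Q * Q) (m≤n⇒m≤1+n s≤m)) (equalDegrees-bound m)
      square : ∀ k → k ≤ k * k
      square zero    = z≤n
      square (suc k) = m≤m+n (suc k) _
      regroup₅ : ∀ s x → s * s * x * x ≡ s * x * (s * x)
      regroup₅ = solve-∀
      W-part : s * (s * s * W) * (s * s * W) ≤ 2 * F * (2 * F)
      W-part = begin
        s * (s * s * W) * (s * s * W)
          -- Only five powers of `s` accompany the square of `W`, while the square of `W-bound`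
          -- absorbs six.
          ≤⟨ *-monoˡ-≤ (s * s * W) (*-monoˡ-≤ (s * s * W) (square s)) ⟩
        s * s * (s * s * W) * (s * s * W)          ≡⟨ regroup₅ s (s * s * W) ⟩
        s * (s * s * W) * (s * (s * s * W))
          ≤⟨ *-mono-≤ (≤-trans (≤-reflexive (regroup₆ s W)) W-bound)
               (≤-trans (≤-reflexive (regroup₆ s W)) W-bound) ⟩
        2 * F * (2 * F)                            ∎
        where
        regroup₆ : ∀ s w → s * (s * s * w) ≡ s * s * s * w
        regroup₆ = solve-∀
      regroup₁ : ∀ b s → b * b * (s * (s * (s * (s * (s * 1))))) ≡ s * s * b * (s * s * b) * s
      regroup₁ = solve-∀
      regroup₂ : ∀ e x s → 2 * (e * x) * (2 * (e * x)) * s ≡ 4 * (e * e) * (x * x * s)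
      regroup₂ = solve-∀
      regroup₃ : ∀ e q s w → 4 * (e * e) * (2 * (4 * q * (4 * q) + s * s * w * (s * s * w)) * s) ≡
                 4 * (e * e) * (2 * (16 * (q * q * s) + s * (s * s * w) * (s * s * w)))
      regroup₃ = solve-∀
      regroup₄ : ∀ e f → 4 * (e * e) * (2 * (16 * (f * f) + 2 * f * (2 * f))) ≡ 40 *
          (2 * f * e * (2 * f * e))
      regroup₄ = solve-∀

-- Union bound

permutation-to : ∀ {m} (u v : Fin (2 + m)) → u ≢ v →
                 ∃[ π ] (π ⟨$⟩ʳ zero ≡ u × π ⟨$⟩ʳ suc zero ≡ v)
permutation-to {m} u v u≢v = Perm.insert zero u (Perm.insert zero (punchOut u≢v) Perm.id) , refl ,
  trans (Perm.insert-punchIn zero u (Perm.insert zero (punchOut u≢v) Perm.id) zero) (punchIn-punchOut u≢v)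

∑-same-relabel : ∀ {m} (u v : Fin (2 + m)) → u ≢ v → ∑ᴳ (2 + m) (λ G → same G u v) ≡ sameCount m
∑-same-relabel {m} u v u≢v with permutation-to u v u≢v
... | π , refl , refl = trans
  (∑ᵛ-cong (edges (2 + m)) (step ∘ unflatten (2 + m)))
  (∑ᴳ-relabel π (λ G → same G zero (suc zero)))
  where
  u′ v′ : Fin (2 + m)
  u′ = π ⟨$⟩ʳ zero
  v′ = π ⟨$⟩ʳ suc zero
  relabelled : ∀ G k → r G k u′ ≡ r G k v′ → r (relabel π G) k zero ≡ r (relabel π G) k (suc zero)
  relabelled G k eq = trans (r-relabel π G k zero) (trans eq (sym (r-relabel π G k (suc zero))))
  original : ∀ G k → r (relabel π G) k zero ≡ r (relabel π G) k (suc zero) → r G k u′ ≡ r G k v′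
  original G k eq = trans (sym (r-relabel π G k zero)) (trans eq (r-relabel π G k (suc zero)))
  step : ∀ G → same G u′ v′ ≡ same (relabel π G) zero (suc zero)
  step G = same-cong G (relabel π G) u′ v′ zero (suc zero)
    (λ (mkSame r₂≡ r₃≡ r₄≡) → mkSame (relabelled G 2 r₂≡) (relabelled G 3 r₃≡) (relabelled G 4 r₄≡))
    (λ (mkSame r₂≡ r₃≡ r₄≡) → mkSame (original G 2 r₂≡) (original G 3 r₃≡) (original G 4 r₄≡))

distinguish : ∀ (G : Graph n) → (∀ u v → u ≢ v → ¬ Same G u v) → Distinguished G
distinguish G differ u v u≢v with r G 2 u ≟ r G 2 v | r G 3 u ≟ r G 3 v | r G 4 u ≟ r G 4 v
... | no r₂≢  | _       | _       = 2 , here refl , r₂≢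
... | yes _   | no r₃≢  | _       = 3 , there (here refl) , r₃≢
... | yes _   | yes _   | no r₄≢  = 4 , there (there (here refl)) , r₄≢
... | yes r₂≡ | yes r₃≡ | yes r₄≡ = contradiction (mkSame r₂≡ r₃≡ r₄≡) (differ u v u≢v)

undistinguished-pair : ∀ (G : Graph n) → ¬ Distinguished G → ∃₂ λ u v → u ≢ v × Same G u v
undistinguished-pair {n} G ¬D =
  let u , ¬row  = ¬∀⟶∃¬ n (λ u → ∀ v → Differ u v) (λ u → all? (differ? u)) (λ differ → ¬D (distinguish G differ))
      v , ¬pair = ¬∀⟶∃¬ n (Differ u) (differ? u) ¬row
  in u , v , (λ u≡v → ¬pair λ u≢v → contradiction u≡v u≢v)
   , decidable-stable (same? G u v) (λ differ → ¬pair λ _ → differ)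
  where
  Differ : Fin n → Fin n → Set
  Differ u v = u ≢ v → ¬ Same G u v
  differ? : ∀ u v → Dec (Differ u v)
  differ? u v = ¬? (u ≟ᶠ v) →-dec ¬? (same? G u v)

≤-sum : ∀ (f : Fin n → ℕ) i → f i ≤ sum f
≤-sum f zero    = m≤m+n (f zero) _
≤-sum f (suc i) = ≤-trans (≤-sum (f ∘ suc) i) (m≤n+m _ (f zero))

sum-≤ : ∀ (f : Fin n → ℕ) c → (∀ i → f i ≤ c) → sum f ≤ n * c
sum-≤ {zero}  f c f≤c = z≤n
sum-≤ {suc n} f c f≤c = +-mono-≤ (f≤c zero) (sum-≤ (f ∘ suc) c (f≤c ∘ suc))

∑ᵛ-sum : ∀ k (f : Fin n → Vec Bool k → ℕ) → ∑ᵛ k (λ p → sum λ i → f i p) ≡ sum λ i → ∑ᵛ k (f i)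
∑ᵛ-sum zero    f = refl
∑ᵛ-sum (suc k) f = trans
    (cong₂ _+_ (∑ᵛ-sum k (λ i → f i ∘ (false ∷_))) (∑ᵛ-sum k (λ i → f i ∘ (true ∷_))))
        (sym (∑-distrib-+ (λ i → ∑ᵛ k (f i ∘ (false ∷_))) (λ i → ∑ᵛ k (f i ∘ (true ∷_)))))

samePair : Graph n → Fin n → Fin n → ℕ
samePair G u v = [ ¬? (u ≟ᶠ v) ] * same G u v

undistinguished≤ : ∀ (G : Graph n) → [ ¬? (distinguished? G) ] ≤ sum λ u → sum λ v → samePair G u v
undistinguished≤ G = go (¬? (distinguished? G))
  where
  open ≤-Reasoning
  hit : ∀ u v → u ≢ v → Same G u v → 1 ≤ sum λ u → sum λ v → samePair G u v
  hit u v u≢v alike = begin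
    1                                    ≡⟨ cong₂ _*_ ([]-yes (¬? (u ≟ᶠ v)) u≢v) (same-yes G u v alike) ⟨
    samePair G u v                       ≤⟨ ≤-sum (samePair G u) v ⟩
    sum (samePair G u)                   ≤⟨ ≤-sum (λ u → sum (samePair G u)) u ⟩
    sum (λ u → sum (samePair G u))       ∎
  go : (D? : Dec (¬ Distinguished G)) → [ D? ] ≤ sum λ u → sum λ v → samePair G u v
  go (no _)   = z≤n
  go (yes ¬D) = let u , v , u≢v , alike = undistinguished-pair G ¬D in hit u v u≢v alike

undistinguished : ℕ → ℕ
undistinguished n = ∑ᴳ n λ G → [ ¬? (distinguished? G) ]

union-bound : ∀ m → undistinguished (2 + m) ≤ (2 + m) * ((2 + m) * sameCount m)
union-bound m = begin
  undistinguished k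
    ≤⟨ ∑ᵛ-mono (edges k) (undistinguished≤ ∘ unflatten k) ⟩
  ∑ᴳ k (λ G → sum λ u → sum λ v → samePair G u v)
    ≡⟨ ∑ᵛ-sum (edges k) (λ u g → sum λ v → samePair (unflatten k g) u v) ⟩
  sum (λ u → ∑ᴳ k λ G → sum λ v → samePair G u v)
    ≤⟨ sum-≤ _ (k * sameCount m) row ⟩
  k * (k * sameCount m)                                                   ∎
  where
  open ≤-Reasoning
  k = 2 + m
  pair : ∀ u v → ∑ᴳ k (λ G → samePair G u v) ≤ sameCount m
  pair u v = ≤-trans (≤-reflexive (∑ᵛ-*ˡ (edges k) [ ¬? (u ≟ᶠ v) ] (λ g → same (unflatten k g) u v)))
      (go (u ≟ᶠ v))
    where
    go : (u≟v : Dec (u ≡ v)) → [ ¬? u≟v ] * ∑ᴳ k (λ G → same G u v) ≤ sameCount m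
    go (yes _)   = z≤n
    go (no u≢v)  = ≤-reflexive (trans (+-identityʳ _) (∑-same-relabel u v u≢v))
  row : ∀ u → ∑ᴳ k (λ G → sum (samePair G u)) ≤ k * sameCount m
  row u = ≤-trans (≤-reflexive (∑ᵛ-sum (edges k) (λ v g → samePair (unflatten k g) u v)))
    (sum-≤ _ (sameCount m) (pair u))

-- The 2 and the remainder add up to at most 34, which is at most 34 times the quotient because the
-- quotient is positive; another 32 come from the division.
≤-66*[m/32] : ∀ m → 32 ≤ m → 2 + m ≤ 66 * (m / 32)
≤-66*[m/32] m 32≤m = begin
  2 + m                    ≡⟨ cong (λ x → 2 + x) (m≡m%n+[m/n]*n m 32) ⟩
  2 + (m % 32 + s * 32)    ≤⟨ +-monoʳ-≤ 2 (+-monoˡ-≤ (s * 32) (<⇒≤ (m%n<n m 32))) ⟩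
  34 + s * 32              ≤⟨ +-monoˡ-≤ (s * 32) (*-monoʳ-≤ 34 (m≥n⇒m/n>0 32≤m)) ⟩
  34 * s + s * 32          ≡⟨ collect s ⟩
  66 * s                   ∎
  where
  open ≤-Reasoning
  s = m / 32
  collect : ∀ s → 34 * s + s * 32 ≡ 66 * s
  collect = solve-∀

-- The constants are kept abstract so that Agda does not unfold multiplication by them.
undistinguished-bound : ∀ m s a c → 32 * s ≤ m → 2 + m ≤ a * s → a ^ 5 * 40 ≤ c * c →
  let N = 2 ^ edges (2 + m) in undistinguished (2 + m) * undistinguished (2 + m) * (2 + m) ≤ c * N * (c * N)
undistinguished-bound m s a c 32s≤m k≤as a⁵≤c² = begin
  U * U * k
    ≤⟨ *-monoˡ-≤ k (*-mono-≤ (union-bound m) (union-bound m)) ⟩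
  k * (k * B) * (k * (k * B)) * k                 ≡⟨ regroup₁ k B ⟩
  k ^ 5 * (B * B)                                 ≤⟨ *-monoˡ-≤ (B * B) (^-monoˡ-≤ 5 k≤as) ⟩
  (a * s) ^ 5 * (B * B)                           ≡⟨ cong (_* (B * B)) (^-distribʳ-* a s 5) ⟩
  a ^ 5 * s ^ 5 * (B * B)                         ≡⟨ regroup₂ (a ^ 5) (s ^ 5) (B * B) ⟩
  a ^ 5 * (B * B * s ^ 5)                         ≤⟨ *-monoʳ-≤ (a ^ 5) (sameCount-bound m s 32s≤m) ⟩
  a ^ 5 * (40 * (N * N))                          ≡⟨ *-assoc (a ^ 5) 40 (N * N) ⟨
  a ^ 5 * 40 * (N * N)                            ≤⟨ *-monoˡ-≤ (N * N) a⁵≤c² ⟩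
  c * c * (N * N)                                 ≡⟨ regroup₃ c N ⟩
  c * N * (c * N)                                 ∎
  where
  open ≤-Reasoning
  k = 2 + m
  U = undistinguished k
  B = sameCount m
  N = 2 ^ edges k
  regroup₁ : ∀ n b → n * (n * b) * (n * (n * b)) * n ≡ n * (n * (n * (n * (n * 1)))) * (b * b)
  regroup₁ = solve-∀
  regroup₂ : ∀ a b c → a * b * c ≡ a * (c * b)
  regroup₂ = solve-∀
  regroup₃ : ∀ a b → a * a * (b * b) ≡ a * b * (a * b)
  regroup₃ = solve-∀

-- From counts to rational probabilities

length-graphs : ∀ n → length (graphs n) ≡ 2 ^ edges n
length-graphs n = trans (length-∑ˡ (graphs n))
    (trans (∑ˡ-graphs n (λ _ → 1)) (trans (∑ᵛ-const (edges n) 1) (*-identityʳ _)))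

distinguished+undistinguished : ∀ n → length
    (filter distinguished? (graphs n)) + undistinguished n ≡ length (graphs n)
distinguished+undistinguished n = begin
  length (filter distinguished? (graphs n)) + undistinguished n
    ≡⟨ cong (_+ undistinguished n)
         (trans (length-filter-∑ˡ distinguished? (graphs n)) (∑ˡ-graphs n (λ G → [ distinguished? G ]))) ⟩
  ∑ᴳ n (λ G → [ distinguished? G ]) + undistinguished n
    ≡⟨ ∑ᵛ-+ (edges n) (λ g → [ distinguished? (unflatten n g) ])
         (λ g → [ ¬? (distinguished? (unflatten n g)) ]) ⟨
  ∑ᴳ n (λ G → [ distinguished? G ] + [ ¬? (distinguished? G) ])
    ≡⟨ ∑ᵛ-cong (edges n) (λ g → complement (distinguished? (unflatten n g))) ⟩
  ∑ᴳ n (λ _ → 1)            ≡⟨ trans (length-∑ˡ (graphs n)) (∑ˡ-graphs n (λ _ → 1)) ⟨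
  length (graphs n)         ∎
  where
  open ≡-Reasoning
  complement : ∀ {P : Set} (P? : Dec P) → [ P? ] + [ ¬? P? ] ≡ 1
  complement (yes _) = refl
  complement (no _)  = refl

complement-fraction : ∀ g b t .{{_ : NonZero t}} → g + b ≡ t → 1ℚᵘ - (ℤ.+ g ℚᵘ./ t) ≃ (ℤ.+ b ℚᵘ./ t)
complement-fraction g b (suc d) g+b≡t = *≡* (subst
  (λ t → (ℤ.+ 1 ℤ.* t ℤ.+ ℤ.- ℤ.+ g ℤ.* ℤ.+ 1) ℤ.* t ≡ ℤ.+ b ℤ.* (ℤ.+ 1 ℤ.* t))
  (cong ℤ.+_ g+b≡t) (identity (ℤ.+ g) (ℤ.+ b)))
  where
  identity : ∀ x y → (ℤ.+ 1 ℤ.* (x ℤ.+ y) ℤ.+ ℤ.- x ℤ.* ℤ.+ 1) ℤ.* (x ℤ.+ y) ≡ y ℤ.* (ℤ.+ 1 ℤ.* (x ℤ.+ y))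
  identity = solveℤ-∀

fraction-bound : ∀ b t n c .{{_ : NonZero t}} → b * b * n ≤ c * t * (c * t) →
                 (ℤ.+ b ℚᵘ./ t) ℚᵘ.* (ℤ.+ b ℚᵘ./ t) ℚᵘ.* (ℤ.+ n ℚᵘ./ 1) ℚᵘ.≤ (ℤ.+ c ℚᵘ./ 1) ℚᵘ.*
                     (ℤ.+ c ℚᵘ./ 1)
fraction-bound b (suc d) n c bound = *≤* (subst₂ ℤ._≤_ lhs rhs (+≤+ bound))
  where
  t = suc d
  lhs : ℤ.+ (b * b * n) ≡ (ℤ.+ b ℤ.* ℤ.+ b ℤ.* ℤ.+ n) ℤ.* ℤ.+ 1
  lhs = trans (ℤ.pos-* (b * b) n) (trans (cong (ℤ._* ℤ.+ n) (ℤ.pos-* b b)) (sym (ℤ.*-identityʳ _)))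
  rhs : ℤ.+ (c * t * (c * t)) ≡ (ℤ.+ c ℤ.* ℤ.+ c) ℤ.* ℤ.+ (t * t * 1)
  rhs = trans (cong ℤ.+_ (regroup c t))
      (trans (ℤ.pos-* (c * c) (t * t * 1)) (cong (ℤ._* ℤ.+ (t * t * 1)) (ℤ.pos-* c c)))
    where
    regroup : ∀ c t → c * t * (c * t) ≡ c * c * (t * t * 1)
    regroup = solve-∀

probability-bound : ∀ n c →
  undistinguished n * undistinguished n * n ≤ c * 2 ^ edges n * (c * 2 ^ edges n) →
  (1ℚᵘ - Pr (distinguished? {n})) ℚᵘ.* (1ℚᵘ - Pr (distinguished? {n})) ℚᵘ.* (ℤ.+ n ℚᵘ./ 1) ℚᵘ.≤
  (ℤ.+ c ℚᵘ./ 1) ℚᵘ.* (ℤ.+ c ℚᵘ./ 1)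
probability-bound n c counts = ℚᵘ.≤-respˡ-≃
    (ℚᵘ.≃-sym (ℚᵘ.*-congʳ {ℤ.+ n ℚᵘ./ 1} (ℚᵘ.*-cong fraction fraction)))
  (fraction-bound (undistinguished n) N n c
    (subst (λ t → undistinguished n * undistinguished n * n ≤ c * t * (c * t))
        (sym (length-graphs n)) counts))
  where
  N : ℕ
  N = length (graphs n)
  instance
    N≢0 : NonZero N
    N≢0 = graphs-nonZero n
  fraction : 1ℚᵘ - Pr (distinguished? {n}) ≃ (ℤ.+ undistinguished n ℚᵘ./ N)
  fraction = complement-fraction (length (filter distinguished? (graphs n))) (undistinguished n) N
      (distinguished+undistinguished n)

undistinguished-bound′ : ∀ m → 32 ≤ m → ∀ c → 66 ^ 5 * 40 ≤ c * c →
  let N = 2 ^ edges (2 + m) in undistinguished (2 + m) * undistinguished (2 + m) * (2 + m) ≤ c * N * (c * N)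
undistinguished-bound′ m 32≤m c = undistinguished-bound m (m / 32) 66 c
  (≤-trans (≤-reflexive (*-comm 32 (m / 32))) (m/n*n≤m m 32)) (≤-66*[m/32] m 32≤m)

theorem4p1 : (λ n → 1ℚᵘ - Pr (distinguished? {n})) ∈O[n^-½]
theorem4p1 = (ℤ.+ c ℚᵘ./ 1) , 34 , bound c (≤ᵇ⇒≤ (66 ^ 5 * 40) (250000 * 250000) tt)
  where
  bound : ∀ c → 66 ^ 5 * 40 ≤ c * c → ∀ n → 34 ≤ n →
          (1ℚᵘ - Pr (distinguished? {n})) ℚᵘ.* (1ℚᵘ - Pr (distinguished? {n})) ℚᵘ.* (ℤ.+ n ℚᵘ./ 1) ℚᵘ.≤
          (ℤ.+ c ℚᵘ./ 1) ℚᵘ.* (ℤ.+ c ℚᵘ./ 1)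
  -- From 34 on, the 32 or more vertices besides 0 and 1 make `m / 32` positive.
  bound c 66⁵≤c² n@(suc (suc m)) (s≤s (s≤s 32≤m)) = probability-bound n c
      (undistinguished-bound′ m 32≤m c 66⁵≤c²)
  -- A round number above the square root of `66 ^ 5 * 40`, which is about 223816.
  c = 250000
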